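{- Let $p\ge5$ be a prime with $\left(\frac{ -10}{p}\right)=-1$. Then for all integers $\alpha\ge1$ and $n\ge0$, \[ b_5\!\left(4 p^{2\alpha}n+\frac{(24i+7p)p^{2\alpha-1}-1}{6}\right)\equiv 0 \pmod 2 \] for each $i=1,2,\ldots,p-1$.
   Context: For a positive integer $\ell$, $b_\ell(n)$ denotes the number of partitions of $n$ having no part divisible by $\ell$. $\left(\frac{a}{p}\right)$ is the Legendre symbol. -}

module Defs where

open import Data.Bool.Base using (if_then_else_)
open import Data.Empty using (⊥-elim)
open import Data.Fin.Base using (Fin; toℕ)
open import Data.Fin.Properties using (any?)
open import Data.Integer.Base as ℤ using (ℤ; 0ℤ; 1ℤ; -1ℤ)
import Data.Integer.Divisibility.Signed as ℤ
open import Data.List.Base using (List; []; _∷_; _++_; map; concatMap; filter; length; replicate; upTo)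
open import Data.List.Properties using (++-cancelˡ; ∷-injective)
open import Data.List.Membership.Propositional using (_∈_; lose; find)
open import Data.List.Membership.Propositional.Properties using (∈-map⁺; ∈-map⁻; ∈-concatMap⁺; ∈-concatMap⁻; ∈-upTo⁺; ∈-upTo⁻)
open import Data.List.Relation.Unary.All as All using (All; []; _∷_)
import Data.List.Relation.Unary.All.Properties as All
open import Data.List.Relation.Unary.AllPairs as AllPairs using (AllPairs; []; _∷_)
import Data.List.Relation.Unary.AllPairs.Properties as AllPairs
open import Data.List.Relation.Unary.Any using (here; there)
open import Data.List.Relation.Unary.Unique.Propositional using (Unique)
import Data.List.Relation.Unary.Unique.Propositional.Properties as Unique
open import Data.List.Relation.Binary.Disjoint.Propositional using (Disjoint)
open import Data.Nat.Base
open import Data.Nat.Divisibility using (_∤_; _∣?_; divides)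
open import Data.Nat.DivMod using (m≡m%n+[m/n]*n; m%n<n; m/n*n≤m; m*n/n≡m; /-monoˡ-≤)
open import Data.Nat.ListAction using (sum)
open import Data.Nat.ListAction.Properties using (sum-++)
open import Data.Nat.Primality using (Prime; prime⇒irreducible)
open import Data.Nat.Properties
open import Data.Nat.Solver using (module +-*-Solver)
open import Data.Product.Base using (∃; _×_; _,_; proj₁; proj₂)
open import Data.Sum.Base using (inj₁; inj₂)
open import Function.Base using (_∘_)
open import Relation.Binary.PropositionalEquality
open import Relation.Nullary using (Dec; does; contradiction)
open import Relation.Nullary.Decidable using (¬?)

-- Fin p serves as a complete residue system mod p; the class of 0 is allowed.
QuadraticResidue : ℤ → ℕ → Set
QuadraticResidue a p = ∃ λ (x : Fin p) → ℤ.+ p ℤ.∣ ℤ.+ toℕ x ℤ.* ℤ.+ toℕ x ℤ.- a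

quadraticResidue? : ∀ a p → Dec (QuadraticResidue a p)
quadraticResidue? a p = any? λ x → ℤ.+ p ℤ.∣? ℤ.+ toℕ x ℤ.* ℤ.+ toℕ x ℤ.- a

-- The Legendre symbol; meaningful only for p an odd prime.
legendre : ℤ → ℕ → ℤ
legendre a p =
  if does (ℤ.+ p ℤ.∣? a) then 0ℤ
  else if does (quadraticResidue? a p) then 1ℤ
  else -1ℤ

record IsPartition (n : ℕ) (xs : List ℕ) : Set where
  constructor isPartition
  field
    positive   : All (1 ≤_) xs
    decreasing : AllPairs _≥_ xs
    total      : sum xs ≡ n

-- The partitions of n into parts at most m, grouped by the multiplicity k of
-- the part m.
partitions≤ : (m n : ℕ) → List (List ℕ)
partitions≤ zero    zero    = [] ∷ []
partitions≤ zero    (suc _) = []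
partitions≤ (suc m) n       =
  concatMap (λ k → map (replicate k (suc m) ++_) (partitions≤ m (n ∸ k * suc m)))
            (upTo (suc (n / suc m)))

-- That this lists every partition of n exactly once is the content of
-- ∈-partitions⁻, ∈-partitions⁺ and partitions-unique.
partitions : ℕ → List (List ℕ)
partitions n = partitions≤ n n

Regular : ℕ → List ℕ → Set
Regular ℓ xs = All (ℓ ∤_) xs

regular? : ∀ ℓ xs → Dec (Regular ℓ xs)
regular? ℓ = All.all? λ x → ¬? (ℓ ∣? x)

b : ℕ → ℕ → ℕ
b ℓ n = length (filter (regular? ℓ) (partitions n))

private
  sum-replicate : ∀ k x → sum (replicate k x) ≡ k * x
  sum-replicate zero    x = refl
  sum-replicate (suc k) x = cong (x +_) (sum-replicate k x)

  sum-block : ∀ k x ys → sum (replicate k x ++ ys) ≡ k * x + sum ys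
  sum-block k x ys = trans (sum-++ (replicate k x) ys) (cong (_+ sum ys) (sum-replicate k x))

  replicate-decreasing : ∀ k x → AllPairs _≥_ (replicate k x)
  replicate-decreasing zero    x = []
  replicate-decreasing (suc k) x = All.replicate⁺ k ≤-refl ∷ replicate-decreasing k x

  ∈-partitions≤⁻ : ∀ m n {xs} → xs ∈ partitions≤ m n → IsPartition n xs × All (_≤ m) xs
  ∈-partitions≤⁻ zero zero (here refl) = isPartition [] [] refl , []
  ∈-partitions≤⁻ (suc m) n xs∈
    with k , k∈ , xs∈ₖ ← find (∈-concatMap⁻ (λ k → map (replicate k (suc m) ++_) (partitions≤ m (n ∸ k * suc m))) {xs = upTo (suc (n / suc m))} xs∈)
    with ys , ys∈ , refl ← ∈-map⁻ (replicate k (suc m) ++_) xs∈ₖ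
    with isPartition pos dec tot , ys≤m ← ∈-partitions≤⁻ m (n ∸ k * suc m) ys∈
    = isPartition
        (All.++⁺ (All.replicate⁺ k (s≤s z≤n)) pos)
        (AllPairs.++⁺ (replicate-decreasing k (suc m)) dec
          (All.replicate⁺ k (All.map m≤n⇒m≤1+n ys≤m)))
        (trans (sum-block k (suc m) ys)
          (trans (cong (_ +_) tot) (m+[n∸m]≡n k*[1+m]≤n)))
    , All.++⁺ (All.replicate⁺ k ≤-refl) (All.map m≤n⇒m≤1+n ys≤m)
    where
    k*[1+m]≤n : k * suc m ≤ n
    k*[1+m]≤n = ≤-trans (*-monoˡ-≤ (suc m) (s≤s⁻¹ (∈-upTo⁻ k∈))) (m/n*n≤m n (suc m))

  split : ∀ m xs → AllPairs _≥_ xs → All (_≤ suc m) xs →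
          ∃ λ k → ∃ λ ys → xs ≡ replicate k (suc m) ++ ys × All (_≤ m) ys
  split m [] _ _ = 0 , [] , refl , []
  split m (x ∷ xs) (x≥xs ∷ dec) (x≤ ∷ xs≤) with m≤n⇒m<n∨m≡n x≤
  ... | inj₁ x<1+m = 0 , x ∷ xs , refl , s≤s⁻¹ x<1+m ∷ All.map (λ y≤x → ≤-trans y≤x (s≤s⁻¹ x<1+m)) x≥xs
  ... | inj₂ refl with k , ys , refl , ys≤m ← split m xs dec xs≤ = suc k , ys , refl , ys≤m

  AllPairs-++⁻ʳ : ∀ (xs : List ℕ) {ys} → AllPairs _≥_ (xs ++ ys) → AllPairs _≥_ ys
  AllPairs-++⁻ʳ []       dec       = dec
  AllPairs-++⁻ʳ (x ∷ xs) (_ ∷ dec) = AllPairs-++⁻ʳ xs dec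

  ∈-partitions≤⁺ : ∀ m n {xs} → IsPartition n xs → All (_≤ m) xs → xs ∈ partitions≤ m n
  ∈-partitions≤⁺ zero _ {[]} (isPartition _ _ refl) _ = here refl
  ∈-partitions≤⁺ zero _ {_ ∷ _} (isPartition (1≤x ∷ _) _ _) (x≤0 ∷ _) = contradiction (≤-trans 1≤x x≤0) λ ()
  ∈-partitions≤⁺ (suc m) n {xs} (isPartition pos dec tot) xs≤
    with k , ys , refl , ys≤m ← split m xs dec xs≤
    = ∈-concatMap⁺ (λ k → map (replicate k (suc m) ++_) (partitions≤ m (n ∸ k * suc m)))
        (lose (∈-upTo⁺ (s≤s k≤))
        (∈-map⁺ (replicate k (suc m) ++_) (∈-partitions≤⁺ m (n ∸ k * suc m)
          (isPartition (All.++⁻ʳ (replicate k (suc m)) pos)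
                       (AllPairs-++⁻ʳ (replicate k (suc m)) dec)
                       (trans (sym (m+n∸m≡n (k * suc m) (sum ys))) (cong (_∸ k * suc m) tot′)))
          ys≤m)))
    where
    tot′ : k * suc m + sum ys ≡ n
    tot′ = trans (sym (sum-block k (suc m) ys)) tot
    k≤ : k ≤ n / suc m
    k≤ = subst (_≤ n / suc m) (m*n/n≡m k (suc m)) (/-monoˡ-≤ (suc m) (≤-trans (m≤m+n (k * suc m) (sum ys)) (≤-reflexive tot′)))

  block-injective : ∀ m k k′ {ys ys′} → All (_≤ m) ys → All (_≤ m) ys′ →
                    replicate k (suc m) ++ ys ≡ replicate k′ (suc m) ++ ys′ → k ≡ k′
  block-injective m zero    zero     _           _            _    = refl
  block-injective m zero    (suc k′) (y≤m ∷ _)   _            refl = contradiction y≤m 1+n≰n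
  block-injective m (suc k) zero     _           (y≤m ∷ _)    refl = contradiction y≤m 1+n≰n
  block-injective m (suc k) (suc k′) ys≤         ys′≤         eq   =
    cong suc (block-injective m k k′ ys≤ ys′≤ (proj₂ (∷-injective eq)))

  partitions≤-unique : ∀ m n → Unique (partitions≤ m n)
  partitions≤-unique zero    zero    = [] ∷ []
  partitions≤-unique zero    (suc n) = []
  partitions≤-unique (suc m) n       = Unique.concat⁺
    (All.map⁺ (All.universal (λ k → Unique.map⁺ (λ {ys} {zs} → ++-cancelˡ (replicate k (suc m)) ys zs)
                                                (partitions≤-unique m (n ∸ k * suc m))) _))
    (AllPairs.map⁺ (AllPairs.map disjoint (Unique.upTo⁺ (suc (n / suc m)))))
    where
    disjoint : ∀ {k k′} → k ≢ k′ →
      Disjoint (map (replicate k  (suc m) ++_) (partitions≤ m (n ∸ k  * suc m)))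
               (map (replicate k′ (suc m) ++_) (partitions≤ m (n ∸ k′ * suc m)))
    disjoint {k} {k′} k≢k′ (xs∈ , xs∈′)
      with ys  , ys∈  , refl ← ∈-map⁻ (replicate k (suc m) ++_) xs∈
      with ys′ , ys′∈ , eq   ← ∈-map⁻ (replicate k′ (suc m) ++_) xs∈′
      = k≢k′ (block-injective m k k′ (proj₂ (∈-partitions≤⁻ m _ ys∈)) (proj₂ (∈-partitions≤⁻ m _ ys′∈)) eq)

  parts≤sum : ∀ xs → All (_≤ sum xs) xs
  parts≤sum []       = []
  parts≤sum (x ∷ xs) = m≤m+n x (sum xs) ∷ All.map (λ y≤ → ≤-trans y≤ (m≤n+m (sum xs) x)) (parts≤sum xs)

∈-partitions⁻ : ∀ n {xs} → xs ∈ partitions n → IsPartition n xs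
∈-partitions⁻ n = proj₁ ∘ ∈-partitions≤⁻ n n

∈-partitions⁺ : ∀ n {xs} → IsPartition n xs → xs ∈ partitions n
∈-partitions⁺ n {xs} P@(isPartition _ _ refl) = ∈-partitions≤⁺ n n P (parts≤sum xs)

partitions-unique : ∀ n → Unique (partitions n)
partitions-unique n = partitions≤-unique n n

private
  p²≡1+6k : ∀ p → Prime p → 5 ≤ p → ∃ λ k → p * p ≡ 1 + 6 * k
  p²≡1+6k p pr 5≤p = go (p % 6) (p / 6) (m%n<n p 6) (m≡m%n+[m/n]*n p 6)
    where
    open +-*-Solver
    not : ∀ d .{{_ : NonTrivial d}} → d < 5 → d ∤ p
    not d d<5 d∣p with prime⇒irreducible pr d∣p
    not .1 {{()}} _ _ | inj₁ refl
    ... | inj₂ refl = <⇒≱ d<5 5≤p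
    go : ∀ r q → r < 6 → p ≡ r + q * 6 → ∃ λ k → p * p ≡ 1 + 6 * k
    go 0 q _ eq = ⊥-elim (not 2 (s≤s (s≤s (s≤s z≤n))) (divides (q * 3)
      (trans eq (solve 1 (λ q → q :* con 6 := q :* con 3 :* con 2) refl q))))
    go 1 q _ refl = 6 * (q * q) + 2 * q ,
      solve 1 (λ q → (con 1 :+ q :* con 6) :* (con 1 :+ q :* con 6)
                  := con 1 :+ con 6 :* (con 6 :* (q :* q) :+ con 2 :* q)) refl q
    go 2 q _ eq = ⊥-elim (not 2 (s≤s (s≤s (s≤s z≤n))) (divides (1 + q * 3)
      (trans eq (solve 1 (λ q → con 2 :+ q :* con 6 := (con 1 :+ q :* con 3) :* con 2) refl q))))
    go 3 q _ eq = ⊥-elim (not 3 (s≤s (s≤s (s≤s (s≤s z≤n)))) (divides (1 + q * 2)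
      (trans eq (solve 1 (λ q → con 3 :+ q :* con 6 := (con 1 :+ q :* con 2) :* con 3) refl q))))
    go 4 q _ eq = ⊥-elim (not 2 (s≤s (s≤s (s≤s z≤n))) (divides (2 + q * 3)
      (trans eq (solve 1 (λ q → con 4 :+ q :* con 6 := (con 2 :+ q :* con 3) :* con 2) refl q))))
    go 5 q _ refl = 6 * (q * q) + 10 * q + 4 ,
      solve 1 (λ q → (con 5 :+ q :* con 6) :* (con 5 :+ q :* con 6)
                  := con 1 :+ con 6 :* (con 6 :* (q :* q) :+ con 10 :* q :+ con 4)) refl q
    go (suc (suc (suc (suc (suc (suc r)))))) _ (s≤s (s≤s (s≤s (s≤s (s≤s (s≤s ())))))) _

  pow≡1+6k : ∀ x k → x ≡ 1 + 6 * k → ∀ a → ∃ λ j → x ^ a ≡ 1 + 6 * j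
  pow≡1+6k x k eq zero = 0 , refl
  pow≡1+6k x k eq (suc a) with j , eqj ← pow≡1+6k x k eq a =
    j + k + 6 * (k * j) , trans (cong₂ _*_ eq eqj)
      (solve 2 (λ k j → (con 1 :+ con 6 :* k) :* (con 1 :+ con 6 :* j)
                     := con 1 :+ con 6 :* (j :+ k :+ con 6 :* (k :* j))) refl k j)
    where open +-*-Solver

  exact : ∀ N t → N ≡ 1 + 6 * t → N ≡ 6 * ((N ∸ 1) / 6) + 1
  exact N t refl = trans (+-comm 1 (6 * t)) (cong (λ s → 6 * s + 1) (sym
    (trans (cong (_/ 6) (*-comm 6 t)) (m*n/n≡m t 6))))

  numerator≡1+6k : ∀ i p P j → p * P ≡ 1 + 6 * j →
                   (24 * i + 7 * p) * P ≡ 1 + 6 * (4 * i * P + 7 * j + 1)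
  numerator≡1+6k i p P j p*P≡ = begin
    (24 * i + 7 * p) * P               ≡⟨ expand 24 7 i p P ⟩
    24 * i * P + 7 * (p * P)           ≡⟨ cong₂ (λ y z → y * P + 7 * z) (*-assoc 6 4 i) p*P≡ ⟩
    6 * (4 * i) * P + 7 * (1 + 6 * j)  ≡⟨ collect (4 * i) P j ⟩
    1 + 6 * (4 * i * P + 7 * j + 1)    ∎
    where
    open +-*-Solver
    open ≡-Reasoning
    expand : ∀ c d i p P → (c * i + d * p) * P ≡ c * i * P + d * (p * P)
    expand = solve 5 (λ c d i p P → (c :* i :+ d :* p) :* P := c :* i :* P :+ d :* (p :* P)) refl
    collect : ∀ u P j → 6 * u * P + 7 * (1 + 6 * j) ≡ 1 + 6 * (u * P + 7 * j + 1)
    collect = solve 3 (λ u P j → con 6 :* u :* P :+ con 7 :* (con 1 :+ con 6 :* j)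
                              := con 1 :+ con 6 :* (u :* P :+ con 7 :* j :+ con 1)) refl

  p^2α≡1+6k : ∀ p → Prime p → 5 ≤ p → ∀ α → ∃ λ j → p ^ (2 * α) ≡ 1 + 6 * j
  p^2α≡1+6k p pr 5≤p α with k , eqk ← p²≡1+6k p pr 5≤p
    with j , eqj ← pow≡1+6k (p * p) k eqk α
    = j , trans (sym (^-*-assoc p 2 α)) (trans (cong (λ y → (p * y) ^ α) (*-identityʳ p)) eqj)

-- The truncated subtraction and the floor division in
-- ((24 * i + 7 * p) * p ^ (2 * α ∸ 1) ∸ 1) / 6 are exact.
offset-exact : ∀ p → Prime p → 5 ≤ p → ∀ α → 1 ≤ α → ∀ i →
  (24 * i + 7 * p) * p ^ (2 * α ∸ 1) ≡ 6 * (((24 * i + 7 * p) * p ^ (2 * α ∸ 1) ∸ 1) / 6) + 1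
offset-exact p pr 5≤p (suc a) _ i =
  exact ((24 * i + 7 * p) * P) (4 * i * P + 7 * proj₁ j + 1)
        (numerator≡1+6k i p P (proj₁ j) (proj₂ j))
  where
  P = p ^ (2 * suc a ∸ 1)
  j = p^2α≡1+6k p pr 5≤p (suc a)

{-# OPTIONS --safe #-}

-- Modulo 2 let F be the generating function of b 5, let f(X) = ∏ (1 − X^ j),
-- and let θ(X) = Σ X^ (k (3k − 1) / 2) and ψ(X) = Σ X^ (k (k + 1) / 2).
-- Euler's pentagonal number theorem f = θ gives F θ(X) = θ(X⁵). Jacobi's
-- θ(X)³ = ψ(X) and the identity θ(X) θ(X⁵) = ψ(X²) + X ψ(X¹⁰) are both parity
-- statements about representations x² + d y² = 24 n + 1 + d with x, y prime to
-- 6 (d = 2 and d = 5); they follow by comparing the fixed points of two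
-- involutions on the points of one binary quadratic form. Since
-- θ(X)² = θ(X²) modulo 2, multiplying F θ(X) = θ(X⁵) by θ(X) and separating even
-- and odd exponents twice yields Σ b 5 (4 n + 1) X^ n = θ(X²) θ(X⁵). Hence
-- b 5 (4 n + 1) is even unless 24 n + 7 = 2 x² + 5 y². As −10 is a
-- non-residue modulo p, the exponent of p in 2 x² + 5 y² is even, whereas it is
-- 2 α − 1 in the values of 24 n + 7 concerned.
module Submission where

open import Data.Bool.Base using (Bool; true; false; not; _∧_; _xor_; if_then_else_)
open import Data.Bool.Properties using (not-involutive; xor-assoc; xor-comm; xor-same; xor-identityʳ; ∧-idem; ∧-comm; ∧-assoc; ∧-zeroʳ; ∧-distribˡ-xor; ∧-distribʳ-xor)
open import Data.Bool.Solver using (module xor-∧-Solver)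
open import Data.Fin.Base using (Fin; toℕ; fromℕ<)
open import Data.Fin.Properties using (all?; toℕ-fromℕ<)
open import Data.Integer.Base as ℤ using (ℤ; +_; -[1+_]; -_; ∣_∣; 0ℤ; 1ℤ; -1ℤ)
import Data.Integer.DivMod as ℤ
import Data.Integer.Divisibility.Signed as ℤ
import Data.Integer.Properties as ℤ
import Data.Integer.Tactic.RingSolver as ℤ
open import Data.List.Base using (List; []; _∷_; _++_; map; concatMap; filter; length; replicate; upTo; applyUpTo; cartesianProduct)
open import Data.List.Properties using (filter-++; filter-reject; length-++; length-map; map-upTo)
open import Data.List.Membership.Propositional using (_∈_; _∉_)
open import Data.List.Membership.Propositional.Properties using (∈-map⁺; ∈-map⁻; ∈-++⁺ˡ; ∈-++⁺ʳ; ∈-∃++; ∈-upTo⁺; ∈-filter⁺; ∈-filter⁻; ∈-cartesianProduct⁺)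
open import Data.List.Membership.Propositional.Properties.WithK using (unique∧set⇒bag)
open import Data.List.Relation.Binary.BagAndSetEquality using (∼bag⇒↭)
open import Data.List.Relation.Binary.Permutation.Propositional using (_↭_; ↭-sym; ↭⇒↭ₛ)
open import Data.List.Relation.Binary.Permutation.Propositional.Properties using (shift; ↭-length; ∈-resp-↭; filter-↭)
import Data.List.Relation.Binary.Permutation.Setoid.Properties as ↭ₛ
open import Data.List.Relation.Unary.All as All using (All; []; _∷_)
import Data.List.Relation.Unary.All.Properties as All
open import Data.List.Relation.Unary.AllPairs using ([]; _∷_)
open import Data.List.Relation.Unary.Any using (here; there)
open import Data.List.Relation.Unary.Unique.Propositional using (Unique)
import Data.List.Relation.Unary.Unique.Propositional.Properties as Unique
open import Data.Nat.Base using (ℕ; zero; suc; _+_; _*_; _∸_; _^_; _/_; _%_; _≤_; _<_; z≤n; s≤s; NonZero; NonTrivial; >-nonZero)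
open import Data.Nat.Coprimality using (Coprime; coprime-Bézout)
open import Data.Nat.Divisibility using (_∣_; _∤_; _∣?_; divides; >⇒∤; ∣m+n∣m⇒∣n; m∣m*n; ∣m⇒∣m*n; ∣n⇒∣m*n; m%n≡0⇒n∣m)
open import Data.Nat.DivMod using (m≡m%n+[m/n]*n; m%n<n; m*n/n≡m; m<n⇒m/n≡0; m/n≡1+[m∸n]/n; %-distribˡ-*; m∣n⇒o%n%m≡o%m)
open import Data.Nat.GCD using (module Bézout)
open import Data.Nat.Induction using (<-rec)
open import Data.Nat.ListAction using (sum)
open import Data.Nat.Primality using (Prime; prime⇒irreducible; prime⇒nonZero; euclidsLemma)
open import Data.Nat.Properties
open import Data.Nat.Tactic.RingSolver using (solve-∀)
open import Data.Product.Base using (∃; _×_; _,_; proj₁; proj₂; map₁)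
open import Data.Product.Properties using (≡-dec)
open import Data.Sum.Base using (_⊎_; inj₁; inj₂; [_,_]′)
open import Function.Base using (_∘_)
open import Function.Bundles using (_⇔_; mk⇔; Equivalence)
open import Relation.Binary.Definitions using (DecidableEquality; tri<; tri≈; tri>)
open import Relation.Binary.PropositionalEquality
open import Relation.Nullary using (¬_; Dec; yes; no; does; contradiction; ¬?)
open import Relation.Nullary.Decidable using (map′; does-⇔; dec-true; dec-false; from-yes; _→-dec_)
open import Relation.Unary using (Pred; Decidable)
open import Defs

open xor-∧-Solver using (solve; _:+_; _:*_; _:=_)

-- Power series over 𝔽₂

-- The obstacle is to find one form on which both involutions act. A number prime to 6 is ±1 modulo
-- 6, so for x and y prime to 6 exactly one sign of x gives x ≡ y modulo 6; put v = (y - x) / 6. If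
-- 1 + d divides 6, as it does for d = 2 and d = 5, then (x² + d y²) / (1 + d) is an integral form
-- in y and v, namely u² + d (e v)² with u = y - e v and e = 6 / (1 + d). The form has more points
-- than wanted: those with 3 ∣ y come from no pair of exponents of the two series. They cancel in
-- pairs under x ↦ -x, so the parity of all points is that of the wanted ones. Complex conjugation
-- pairs off the same points differently and leaves those on the axes v = 0 and u = 0, where the
-- form is y² and d y² respectively; there squares, hence ψ, appear. Infinite products and inverses
-- of series are avoided: generating functions with bounded parts meet finite products, coefficients
-- are compared degree by degree, and θ is cancelled by virtue of its constant term 1.

Series : Set
Series = ℕ → Bool

tail : Series → Series
tail f n = f (suc n)

infixl 6 _⊕_
infixl 7 _⊛_
infixr 8 X·_

_⊕_ : Series → Series → Series
(f ⊕ g) n = f n xor g n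

_⊛_ : Series → Series → Series
(f ⊛ g) zero    = f 0 ∧ g 0
(f ⊛ g) (suc n) = (f 0 ∧ g (suc n)) xor (tail f ⊛ g) n

𝟙 : Series
𝟙 zero    = true
𝟙 (suc n) = false

X·_ : Series → Series
(X· f) zero    = false
(X· f) (suc n) = f n

xor-interchange : ∀ a b c d → (a xor b) xor (c xor d) ≡ (a xor c) xor (b xor d)
xor-interchange = solve 4 (λ a b c d → (a :+ b) :+ (c :+ d) := (a :+ c) :+ (b :+ d)) refl

-- This takes the place of convergence: truncations may stand in for the full series up to a given
-- degree.
⊛-cong-≤ : ∀ {f f′ g g′} n → (∀ i → i ≤ n → f i ≡ f′ i) → (∀ i → i ≤ n → g i ≡ g′ i) →
           (f ⊛ g) n ≡ (f′ ⊛ g′) n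
⊛-cong-≤ zero    f≡ g≡ = cong₂ _∧_ (f≡ 0 z≤n) (g≡ 0 z≤n)
⊛-cong-≤ (suc n) f≡ g≡ = cong₂ _xor_
  (cong₂ _∧_ (f≡ 0 z≤n) (g≡ (suc n) ≤-refl))
  (⊛-cong-≤ n (λ i i≤n → f≡ (suc i) (s≤s i≤n)) (λ i i≤n → g≡ i (m≤n⇒m≤1+n i≤n)))

⊛-cong : ∀ {f f′ g g′} → f ≗ f′ → g ≗ g′ → f ⊛ g ≗ f′ ⊛ g′
⊛-cong f≗ g≗ n = ⊛-cong-≤ n (λ i _ → f≗ i) (λ i _ → g≗ i)

⊛-congˡ : ∀ f {g g′} → g ≗ g′ → f ⊛ g ≗ f ⊛ g′
⊛-congˡ f = ⊛-cong {f} λ _ → refl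

⊛-congʳ : ∀ g {f f′} → f ≗ f′ → f ⊛ g ≗ f′ ⊛ g
⊛-congʳ g f≗ = ⊛-cong {g = g} f≗ λ _ → refl

⊛-distribʳ-⊕ : ∀ f g h → (f ⊕ g) ⊛ h ≗ f ⊛ h ⊕ g ⊛ h
⊛-distribʳ-⊕ f g h zero    = ∧-distribʳ-xor (h 0) (f 0) (g 0)
⊛-distribʳ-⊕ f g h (suc n) = trans
  (cong₂ _xor_ (∧-distribʳ-xor (h (suc n)) (f 0) (g 0)) (⊛-distribʳ-⊕ (tail f) (tail g) h n))
  (xor-interchange (f 0 ∧ h (suc n)) (g 0 ∧ h (suc n)) _ _)

∧-⊛-assoc : ∀ c f g → (λ n → c ∧ f n) ⊛ g ≗ λ n → c ∧ (f ⊛ g) n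
∧-⊛-assoc c f g zero    = ∧-assoc c (f 0) (g 0)
∧-⊛-assoc c f g (suc n) = trans
  (cong₂ _xor_ (∧-assoc c (f 0) (g (suc n))) (∧-⊛-assoc c (tail f) g n))
  (sym (∧-distribˡ-xor c (f 0 ∧ g (suc n)) _))

-- The mirror image of the defining recursion, with the constant term of `g` split off;
-- commutativity and the squaring law rest on it.
⊛-sucʳ : ∀ f g n → (f ⊛ g) (suc n) ≡ (f (suc n) ∧ g 0) xor (f ⊛ tail g) n
⊛-sucʳ f g zero    = xor-comm (f 0 ∧ g 1) (f 1 ∧ g 0)
⊛-sucʳ f g (suc n) = trans
  (cong ((f 0 ∧ g (suc (suc n))) xor_) (⊛-sucʳ (tail f) g n))
  (solve 3 (λ a b c → a :+ (b :+ c) := b :+ (a :+ c)) refl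
    (f 0 ∧ g (suc (suc n))) (f (suc (suc n)) ∧ g 0) ((tail f ⊛ tail g) n))

⊛-comm : ∀ f g → f ⊛ g ≗ g ⊛ f
⊛-comm f g zero    = ∧-comm (f 0) (g 0)
⊛-comm f g (suc n) = trans
  (cong₂ _xor_ (∧-comm (f 0) (g (suc n))) (⊛-comm (tail f) g n))
  (sym (⊛-sucʳ g f n))

⊛-assoc : ∀ f g h → (f ⊛ g) ⊛ h ≗ f ⊛ (g ⊛ h)
⊛-assoc f g h zero    = ∧-assoc (f 0) (g 0) (h 0)
⊛-assoc f g h (suc n) = begin
  ((f 0 ∧ g 0) ∧ h (suc n)) xor (tail (f ⊛ g) ⊛ h) n
    ≡⟨ cong₂ _xor_ (∧-assoc (f 0) (g 0) (h (suc n)))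
         (⊛-distribʳ-⊕ (λ k → f 0 ∧ tail g k) (tail f ⊛ g) h n) ⟩
  (f 0 ∧ (g 0 ∧ h (suc n))) xor (((λ k → f 0 ∧ tail g k) ⊛ h) n xor ((tail f ⊛ g) ⊛ h) n)
    ≡⟨ cong ((f 0 ∧ (g 0 ∧ h (suc n))) xor_)
         (cong₂ _xor_ (∧-⊛-assoc (f 0) (tail g) h n) (⊛-assoc (tail f) g h n)) ⟩
  (f 0 ∧ (g 0 ∧ h (suc n))) xor ((f 0 ∧ (tail g ⊛ h) n) xor (tail f ⊛ (g ⊛ h)) n)
    ≡⟨ solve 4 (λ a b c d → a :* b :+ (a :* c :+ d) := a :* (b :+ c) :+ d) refl
         (f 0) (g 0 ∧ h (suc n)) ((tail g ⊛ h) n) ((tail f ⊛ (g ⊛ h)) n) ⟩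
  (f 0 ∧ (g ⊛ h) (suc n)) xor (tail f ⊛ (g ⊛ h)) n ∎
  where open ≡-Reasoning

-- Apart from `f 0 ∧ g (suc n)`, the coefficient at `suc n` involves only earlier coefficients of
-- `g`, so strong induction recovers `g` without inverting `f`.
⊛-cancelˡ : ∀ f {g h} → f 0 ≡ true → f ⊛ g ≗ f ⊛ h → g ≗ h
⊛-cancelˡ f {g} {h} f₀≡1 eq = <-rec (λ n → g n ≡ h n) step
  where
  cancelˡ : ∀ {a b c d e} → a ≡ true → (a ∧ b) xor c ≡ (a ∧ d) xor e → c ≡ e → b ≡ d
  cancelˡ {b = b} {c} {d} refl eq refl =
    trans (un b c) (trans (cong (_xor c) eq) (sym (un d c)))
    where
    un : ∀ x y → x ≡ (x xor y) xor y
    un = solve 2 (λ x y → x := (x :+ y) :+ y) refl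
  step : ∀ n → (∀ {i} → i < n → g i ≡ h i) → g n ≡ h n
  step zero    _   = trans (sym (cong (_∧ g 0) f₀≡1)) (trans (eq 0) (cong (_∧ h 0) f₀≡1))
  step (suc n) rec = cancelˡ f₀≡1 (eq (suc n)) (⊛-cong-≤ {tail f} n (λ _ _ → refl) (λ i i≤n → rec (s≤s i≤n)))

X·-⊛ : ∀ f g → (X· f) ⊛ g ≗ X· (f ⊛ g)
X·-⊛ f g zero    = refl
X·-⊛ f g (suc n) = refl

⊛-identityˡ : ∀ f → 𝟙 ⊛ f ≗ f
⊛-identityˡ f zero    = refl
⊛-identityˡ f (suc n) = trans (cong (f (suc n) xor_) (zeroˡ f n)) (xor-identityʳ (f (suc n)))
  where
  zeroˡ : ∀ f n → ((λ _ → false) ⊛ f) n ≡ false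
  zeroˡ f zero    = refl
  zeroˡ f (suc n) = zeroˡ f n


-- Substituting X² or X⁵, and even and odd parts

double : ℕ → ℕ
double zero    = zero
double (suc n) = suc (suc (double n))

spread₂ : Series → Series
spread₂ f zero          = f 0
spread₂ f (suc zero)    = false
spread₂ f (suc (suc n)) = spread₂ (tail f) n

even odd : Series → Series
even f n = f (double n)
odd  f n = f (suc (double n))

-- The two outermost terms of the convolution agree and cancel in characteristic 2; what remains is
-- the square of `tail f`, two degrees lower.
⊛-self : ∀ f → f ⊛ f ≗ spread₂ f
⊛-self f zero          = ∧-idem (f 0)
⊛-self f (suc zero)    = trans (cong ((f 0 ∧ f 1) xor_) (∧-comm (f 1) (f 0))) (xor-same (f 0 ∧ f 1))
⊛-self f (suc (suc n)) = begin
  (f 0 ∧ f (2 + n)) xor (tail f ⊛ f) (suc n)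
    ≡⟨ cong ((f 0 ∧ f (2 + n)) xor_) (⊛-sucʳ (tail f) f n) ⟩
  (f 0 ∧ f (2 + n)) xor ((f (2 + n) ∧ f 0) xor (tail f ⊛ tail f) n)
    ≡⟨ solve 3 (λ a b c → a :* b :+ (b :* a :+ c) := c) refl (f 0) (f (2 + n)) ((tail f ⊛ tail f) n) ⟩
  (tail f ⊛ tail f) n
    ≡⟨ ⊛-self (tail f) n ⟩
  spread₂ (tail f) n ∎
  where open ≡-Reasoning

-- A factor f(X²) has even exponents only, so it acts on the even and the odd part of `g`
-- separately. Two steps of the convolution match one step of `double`.
even-spread₂-⊛ : ∀ f g → even (spread₂ f ⊛ g) ≗ f ⊛ even g
even-spread₂-⊛ f g zero    = refl
even-spread₂-⊛ f g (suc n) = cong ((f 0 ∧ even g (suc n)) xor_) (even-spread₂-⊛ (tail f) g n)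

odd-spread₂-⊛ : ∀ f g → odd (spread₂ f ⊛ g) ≗ f ⊛ odd g
odd-spread₂-⊛ f g zero    = xor-identityʳ (f 0 ∧ g 1)
odd-spread₂-⊛ f g (suc n) = cong ((f 0 ∧ odd g (suc n)) xor_) (odd-spread₂-⊛ (tail f) g n)

spread₅ : Series → Series
spread₅ f 0 = f 0
spread₅ f 1 = false
spread₅ f 2 = false
spread₅ f 3 = false
spread₅ f 4 = false
spread₅ f (suc (suc (suc (suc (suc n))))) = spread₅ (tail f) n

spread₅-cong-≤ : ∀ {f g} n → (∀ i → i ≤ n → f i ≡ g i) → spread₅ f n ≡ spread₅ g n
spread₅-cong-≤ 0 eq = eq 0 z≤n
spread₅-cong-≤ 1 eq = refl
spread₅-cong-≤ 2 eq = refl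
spread₅-cong-≤ 3 eq = refl
spread₅-cong-≤ 4 eq = refl
spread₅-cong-≤ (suc (suc (suc (suc (suc n))))) eq =
  spread₅-cong-≤ n λ i i≤n → eq (suc i) (s≤s (≤-trans i≤n (m≤n+m n 4)))

spread₅-cong : ∀ {f g} → f ≗ g → spread₅ f ≗ spread₅ g
spread₅-cong eq n = spread₅-cong-≤ n λ i _ → eq i

spread₅-⊕ : ∀ f g → spread₅ (f ⊕ g) ≗ spread₅ f ⊕ spread₅ g
spread₅-⊕ f g 0 = refl
spread₅-⊕ f g 1 = refl
spread₅-⊕ f g 2 = refl
spread₅-⊕ f g 3 = refl
spread₅-⊕ f g 4 = refl
spread₅-⊕ f g (suc (suc (suc (suc (suc n))))) = spread₅-⊕ (tail f) (tail g) n

spread₅-∧ : ∀ c f n → spread₅ (λ k → c ∧ f k) n ≡ c ∧ spread₅ f n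
spread₅-∧ c f 0 = refl
spread₅-∧ c f 1 = sym (∧-zeroʳ c)
spread₅-∧ c f 2 = sym (∧-zeroʳ c)
spread₅-∧ c f 3 = sym (∧-zeroʳ c)
spread₅-∧ c f 4 = sym (∧-zeroʳ c)
spread₅-∧ c f (suc (suc (suc (suc (suc n))))) = spread₅-∧ c (tail f) n

spread₅-⊛ : ∀ f g → spread₅ (f ⊛ g) ≗ spread₅ f ⊛ spread₅ g
spread₅-⊛ f g 0 = refl
spread₅-⊛ f g 1 = sym (trans (xor-identityʳ _) (∧-zeroʳ (f 0)))
spread₅-⊛ f g 2 = sym (trans (xor-identityʳ _) (∧-zeroʳ (f 0)))
spread₅-⊛ f g 3 = sym (trans (xor-identityʳ _) (∧-zeroʳ (f 0)))
spread₅-⊛ f g 4 = sym (trans (xor-identityʳ _) (∧-zeroʳ (f 0)))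
spread₅-⊛ f g (suc (suc (suc (suc (suc n))))) = begin
  spread₅ ((λ k → f 0 ∧ tail g k) ⊕ (tail f ⊛ g)) n
    ≡⟨ spread₅-⊕ (λ k → f 0 ∧ tail g k) (tail f ⊛ g) n ⟩
  spread₅ (λ k → f 0 ∧ tail g k) n xor spread₅ (tail f ⊛ g) n
    ≡⟨ cong₂ _xor_ (spread₅-∧ (f 0) (tail g) n) (spread₅-⊛ (tail f) g n) ⟩
  (f 0 ∧ spread₅ (tail g) n) xor (spread₅ (tail f) ⊛ spread₅ g) n ∎
  where open ≡-Reasoning

-- Multiplication by monomials and by 1 + X^k

X^_·_ : ℕ → Series → Series
X^ zero  · f = f
X^ suc k · f = X· (X^ k · f)

infixr 8 X^_·_ 1+X^_·_

1+X^_·_ : ℕ → Series → Series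
1+X^ k · f = f ⊕ X^ k · f

X·-cong : ∀ {f g} → f ≗ g → X· f ≗ X· g
X·-cong eq zero    = refl
X·-cong eq (suc n) = eq n

X^-cong : ∀ k {f g} → f ≗ g → X^ k · f ≗ X^ k · g
X^-cong zero    eq = eq
X^-cong (suc k) eq = X·-cong (X^-cong k eq)

X^-⊛ : ∀ k f g → (X^ k · f) ⊛ g ≗ X^ k · (f ⊛ g)
X^-⊛ zero    f g n = refl
X^-⊛ (suc k) f g n = trans (X·-⊛ (X^ k · f) g n) (X·-cong (X^-⊛ k f g) n)

X^-< : ∀ k f {n} → n < k → (X^ k · f) n ≡ false
X^-< (suc k) f {zero}  _         = refl
X^-< (suc k) f {suc n} (s≤s n<k) = X^-< k f n<k

X^-+ : ∀ k f n → (X^ k · f) (k + n) ≡ f n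
X^-+ zero    f n = refl
X^-+ (suc k) f n = X^-+ k f n

X^-* : ∀ j k f → X^ (j + k) · f ≡ X^ j · X^ k · f
X^-* zero    k f = refl
X^-* (suc j) k f = cong X·_ (X^-* j k f)

X^-⊕ : ∀ k f g → X^ k · (f ⊕ g) ≗ X^ k · f ⊕ X^ k · g
X^-⊕ zero    f g n       = refl
X^-⊕ (suc k) f g zero    = refl
X^-⊕ (suc k) f g (suc n) = X^-⊕ k f g n

1+X^-cong : ∀ k {f g} → f ≗ g → 1+X^ k · f ≗ 1+X^ k · g
1+X^-cong k eq n = cong₂ _xor_ (eq n) (X^-cong k eq n)

1+X^-⊛ˡ : ∀ k f g → (1+X^ k · f) ⊛ g ≗ 1+X^ k · (f ⊛ g)
1+X^-⊛ˡ k f g n = trans (⊛-distribʳ-⊕ f (X^ k · f) g n) (cong ((f ⊛ g) n xor_) (X^-⊛ k f g n))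

1+X^-⊛ʳ : ∀ k f g → f ⊛ (1+X^ k · g) ≗ 1+X^ k · (f ⊛ g)
1+X^-⊛ʳ k f g n = trans (⊛-comm f (1+X^ k · g) n)
  (trans (1+X^-⊛ˡ k g f n) (1+X^-cong k (⊛-comm g f) n))

X^-comm : ∀ j k f → X^ j · X^ k · f ≡ X^ k · X^ j · f
X^-comm j k f = trans (sym (X^-* j k f)) (trans (cong (X^_· f) (+-comm j k)) (X^-* k j f))

1+X^-comm : ∀ j k f → 1+X^ j · 1+X^ k · f ≗ 1+X^ k · 1+X^ j · f
1+X^-comm j k f n = begin
  (f n xor (X^ k · f) n) xor (X^ j · (f ⊕ X^ k · f)) n
    ≡⟨ cong ((f n xor (X^ k · f) n) xor_) (X^-⊕ j f (X^ k · f) n) ⟩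
  (f n xor (X^ k · f) n) xor ((X^ j · f) n xor (X^ j · X^ k · f) n)
    ≡⟨ xor-interchange (f n) _ _ _ ⟩
  (f n xor (X^ j · f) n) xor ((X^ k · f) n xor (X^ j · X^ k · f) n)
    ≡⟨ cong (λ h → (f n xor (X^ j · f) n) xor ((X^ k · f) n xor h n)) (X^-comm j k f) ⟩
  (f n xor (X^ j · f) n) xor ((X^ k · f) n xor (X^ k · X^ j · f) n)
    ≡⟨ cong ((f n xor (X^ j · f) n) xor_) (sym (X^-⊕ k f (X^ j · f) n)) ⟩
  (f n xor (X^ j · f) n) xor (X^ k · (f ⊕ X^ j · f)) n ∎
  where open ≡-Reasoning

spread₅-X^ : ∀ k f → spread₅ (X^ k · f) ≗ X^ (5 * k) · spread₅ f
spread₅-X^ zero    f n = refl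
spread₅-X^ (suc k) f n = trans (lemma (X^ k · f) n)
  (trans (X^-cong 5 (spread₅-X^ k f) n)
  (trans (cong (λ h → h n) (sym (X^-* 5 (5 * k) (spread₅ f))))
         (cong (λ e → (X^ e · spread₅ f) n) (sym (*-suc 5 k)))))
  where
  lemma : ∀ f → spread₅ (X· f) ≗ X^ 5 · spread₅ f
  lemma f 0 = refl
  lemma f 1 = refl
  lemma f 2 = refl
  lemma f 3 = refl
  lemma f 4 = refl
  lemma f (suc (suc (suc (suc (suc n))))) = refl

spread₅-1+X^ : ∀ k f → spread₅ (1+X^ k · f) ≗ 1+X^ (5 * k) · spread₅ f
spread₅-1+X^ k f n = trans (spread₅-⊕ f (X^ k · f) n) (cong (spread₅ f n xor_) (spread₅-X^ k f n))

-- Regular partitions modulo 2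

isOdd : ℕ → Bool
isOdd zero    = false
isOdd (suc n) = not (isOdd n)

isOdd-+ : ∀ m n → isOdd (m + n) ≡ isOdd m xor isOdd n
isOdd-+ zero    n = refl
isOdd-+ (suc m) n with isOdd m | isOdd-+ m n
... | true  | eq = trans (cong not eq) (not-involutive (isOdd n))
... | false | eq = cong not eq

¬isOdd⇒2∣ : ∀ n → isOdd n ≡ false → 2 ∣ n
¬isOdd⇒2∣ zero          _  = divides 0 refl
¬isOdd⇒2∣ (suc (suc n)) eq with divides q refl ← ¬isOdd⇒2∣ n (trans (sym (not-involutive (isOdd n))) eq) =
  divides (suc q) refl

module _ {p} {A : Set} {P : Pred A p} (P? : Decidable P) where

  length-filter-concatMap : {B : Set} (f : B → List A) → ∀ xs →
    length (filter P? (concatMap f xs)) ≡ sum (map (length ∘ filter P? ∘ f) xs)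
  length-filter-concatMap f []       = refl
  length-filter-concatMap f (x ∷ xs) = trans
    (cong length (filter-++ P? (f x) (concatMap f xs)))
    (trans (length-++ (filter P? (f x))) (cong (λ k → _ + k) (length-filter-concatMap f xs)))

  length-filter-map : ∀ (f : A → A) → (∀ x → P (f x) ⇔ P x) → ∀ xs →
    length (filter P? (map f xs)) ≡ length (filter P? xs)
  length-filter-map f iff []       = refl
  length-filter-map f iff (x ∷ xs) with P? (f x) | P? x
  ... | yes _   | yes _  = cong suc (length-filter-map f iff xs)
  ... | yes Pfx | no ¬Px = contradiction (Equivalence.to (iff x) Pfx) ¬Px
  ... | no ¬Pfx | yes Px = contradiction (Equivalence.from (iff x) Px) ¬Pfx
  ... | no _    | no _   = length-filter-map f iff xs

  length-filter-map-none : ∀ (f : A → A) → (∀ x → ¬ P (f x)) → ∀ xs → length (filter P? (map f xs)) ≡ 0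
  length-filter-map-none f ¬P []       = refl
  length-filter-map-none f ¬P (x ∷ xs) with P? (f x)
  ... | yes Pfx = contradiction Pfx (¬P x)
  ... | no _    = length-filter-map-none f ¬P xs

sum-applyUpTo-cong : ∀ {f g : ℕ → ℕ} → f ≗ g → ∀ n → sum (applyUpTo f n) ≡ sum (applyUpTo g n)
sum-applyUpTo-cong eq zero    = refl
sum-applyUpTo-cong eq (suc n) = cong₂ _+_ (eq 0) (sum-applyUpTo-cong (eq ∘ suc) n)

sum-applyUpTo-0 : ∀ n → sum (applyUpTo (λ _ → 0) n) ≡ 0
sum-applyUpTo-0 zero    = refl
sum-applyUpTo-0 (suc n) = sum-applyUpTo-0 n

b≤ : ℕ → ℕ → ℕ → ℕ
b≤ ℓ m n = length (filter (regular? ℓ) (partitions≤ m n))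

module _ (ℓ m : ℕ) where

  private
    block : ℕ → ℕ → List (List ℕ)
    block n k = map (replicate k (suc m) ++_) (partitions≤ m (n ∸ k * suc m))

    blockCount : ℕ → ℕ → ℕ
    blockCount n k = length (filter (regular? ℓ) (block n k))

    b≤-suc : ∀ n → b≤ ℓ (suc m) n ≡ sum (applyUpTo (blockCount n) (suc (n / suc m)))
    b≤-suc n = trans (length-filter-concatMap (regular? ℓ) (block n) (upTo (suc (n / suc m))))
      (cong sum (map-upTo (blockCount n) (suc (n / suc m))))

    blockCount-0 : ∀ n → blockCount n 0 ≡ b≤ ℓ m n
    blockCount-0 n = length-filter-map (regular? ℓ) ([] ++_) (λ _ → mk⇔ (λ r → r) (λ r → r)) (partitions≤ m n)

    blockCount-∤ : ℓ ∤ suc m → ∀ n k → blockCount n k ≡ b≤ ℓ m (n ∸ k * suc m)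
    blockCount-∤ ℓ∤ n k = length-filter-map (regular? ℓ) (replicate k (suc m) ++_)
      (λ xs → mk⇔ (All.++⁻ʳ (replicate k (suc m))) (All.++⁺ (All.replicate⁺ k ℓ∤)))
      (partitions≤ m (n ∸ k * suc m))

    blockCount-∣ : ℓ ∣ suc m → ∀ n k → blockCount n (suc k) ≡ 0
    blockCount-∣ ℓ∣ n k = length-filter-map-none (regular? ℓ) (replicate (suc k) (suc m) ++_)
      (λ { _ (ℓ∤ ∷ _) → contradiction ℓ∣ ℓ∤ }) (partitions≤ m (n ∸ suc k * suc m))

  b≤-∣ : ℓ ∣ suc m → ∀ n → b≤ ℓ (suc m) n ≡ b≤ ℓ m n
  b≤-∣ ℓ∣ n = begin
    b≤ ℓ (suc m) n
      ≡⟨ b≤-suc n ⟩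
    blockCount n 0 + sum (applyUpTo (blockCount n ∘ suc) (n / suc m))
      ≡⟨ cong₂ _+_ (blockCount-0 n) (sum-applyUpTo-cong (blockCount-∣ ℓ∣ n) (n / suc m)) ⟩
    b≤ ℓ m n + sum (applyUpTo (λ _ → 0) (n / suc m))
      ≡⟨ cong (λ k → b≤ ℓ m n + k) (sum-applyUpTo-0 (n / suc m)) ⟩
    b≤ ℓ m n + 0
      ≡⟨ +-identityʳ _ ⟩
    b≤ ℓ m n ∎
    where open ≡-Reasoning

  b≤-> : ∀ {n} → n < suc m → b≤ ℓ (suc m) n ≡ b≤ ℓ m n
  b≤-> {n} n<1+m = begin
    b≤ ℓ (suc m) n
      ≡⟨ b≤-suc n ⟩
    blockCount n 0 + sum (applyUpTo (blockCount n ∘ suc) (n / suc m))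
      ≡⟨ cong₂ (λ c q → c + sum (applyUpTo (blockCount n ∘ suc) q)) (blockCount-0 n) (m<n⇒m/n≡0 n<1+m) ⟩
    b≤ ℓ m n + 0
      ≡⟨ +-identityʳ _ ⟩
    b≤ ℓ m n ∎
    where open ≡-Reasoning

  -- Removing one copy of the part `suc m` matches multiplicity `suc k` in `suc m + n` with
  -- multiplicity `k` in `n`; the first summand is multiplicity zero. For generating functions this
  -- is division by 1 - X^(m+1).
  b≤-∤ : ℓ ∤ suc m → ∀ n → b≤ ℓ (suc m) (suc m + n) ≡ b≤ ℓ m (suc m + n) + b≤ ℓ (suc m) n
  b≤-∤ ℓ∤ n = begin
    b≤ ℓ (suc m) N
      ≡⟨ b≤-suc N ⟩
    sum (applyUpTo (blockCount N) (suc (N / suc m)))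
      ≡⟨ sum-applyUpTo-cong (blockCount-∤ ℓ∤ N) (suc (N / suc m)) ⟩
    b≤ ℓ m N + sum (applyUpTo (λ k → b≤ ℓ m (N ∸ suc k * suc m)) (N / suc m))
      ≡⟨ cong (λ q → b≤ ℓ m N + sum (applyUpTo (λ k → b≤ ℓ m (N ∸ suc k * suc m)) q)) N/≡ ⟩
    b≤ ℓ m N + sum (applyUpTo (λ k → b≤ ℓ m (N ∸ suc k * suc m)) (suc (n / suc m)))
      ≡⟨ cong (λ k → b≤ ℓ m N + k) (sum-applyUpTo-cong reindex (suc (n / suc m))) ⟩
    b≤ ℓ m N + sum (applyUpTo (blockCount n) (suc (n / suc m)))
      ≡⟨ cong (λ k → b≤ ℓ m N + k) (b≤-suc n) ⟨
    b≤ ℓ m N + b≤ ℓ (suc m) n ∎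
    where
    open ≡-Reasoning
    N = suc m + n
    N/≡ : N / suc m ≡ suc (n / suc m)
    N/≡ = trans (m/n≡1+[m∸n]/n (m≤m+n (suc m) n)) (cong (λ k → suc (k / suc m)) (m+n∸m≡n (suc m) n))
    reindex : ∀ k → b≤ ℓ m (N ∸ suc k * suc m) ≡ blockCount n k
    reindex k = trans (cong (b≤ ℓ m) ([m+n]∸[m+o]≡n∸o (suc m) n (k * suc m))) (sym (blockCount-∤ ℓ∤ n k))

B≤ : ℕ → Series
B≤ m n = isOdd (b≤ 5 m n)

B : Series
B n = isOdd (b 5 n)

B≤-stable : ∀ {m n} → n ≤ m → B≤ m n ≡ B n
B≤-stable {zero}  z≤n = refl
B≤-stable {suc m} {n} n≤1+m with m≤n⇒m<n∨m≡n n≤1+m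
... | inj₁ n<1+m = trans (cong isOdd (b≤-> 5 m n<1+m)) (B≤-stable (≤-pred n<1+m))
... | inj₂ refl  = refl

1+X^-B≤ : ∀ m → 5 ∤ suc m → 1+X^ suc m · B≤ (suc m) ≗ B≤ m
1+X^-B≤ m 5∤ n with suc m ≤? n
... | no m≮n = trans (cong (B≤ (suc m) n xor_) (X^-< (suc m) (B≤ (suc m)) (≰⇒> m≮n)))
  (trans (xor-identityʳ _) (cong isOdd (b≤-> 5 m (≰⇒> m≮n))))
... | yes m<n with n′ , refl ← m≤n⇒∃[o]m+o≡n m<n = begin
  B≤ (suc m) n xor (X^ suc m · B≤ (suc m)) n
    ≡⟨ cong₂ _xor_ (trans (cong isOdd (b≤-∤ 5 m 5∤ n′)) (isOdd-+ (b≤ 5 m n) (b≤ 5 (suc m) n′)))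
         (X^-+ (suc m) (B≤ (suc m)) n′) ⟩
  (B≤ m n xor B≤ (suc m) n′) xor B≤ (suc m) n′
    ≡⟨ xor-assoc (B≤ m n) _ _ ⟩
  B≤ m n xor (B≤ (suc m) n′ xor B≤ (suc m) n′)
    ≡⟨ cong (B≤ m n xor_) (xor-same (B≤ (suc m) n′)) ⟩
  B≤ m n xor false
    ≡⟨ xor-identityʳ _ ⟩
  B≤ m n ∎
  where open ≡-Reasoning

-- The product of 1 + X^ j over s < j ≤ s + l.
Π1+X^ : ℕ → ℕ → Series
Π1+X^ s zero    = 𝟙
Π1+X^ s (suc l) = 1+X^ suc (s + l) · Π1+X^ s l

B≤-0 : B≤ 0 ≗ 𝟙
B≤-0 zero    = refl
B≤-0 (suc n) = refl

Π-B≤-∤ : ∀ m → 5 ∤ suc m → Π1+X^ 0 (suc m) ⊛ B≤ (suc m) ≗ Π1+X^ 0 m ⊛ B≤ m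
Π-B≤-∤ m 5∤ n = begin
  ((1+X^ suc m · Π1+X^ 0 m) ⊛ B≤ (suc m)) n
    ≡⟨ 1+X^-⊛ˡ (suc m) (Π1+X^ 0 m) (B≤ (suc m)) n ⟩
  (1+X^ suc m · (Π1+X^ 0 m ⊛ B≤ (suc m))) n
    ≡⟨ 1+X^-⊛ʳ (suc m) (Π1+X^ 0 m) (B≤ (suc m)) n ⟨
  (Π1+X^ 0 m ⊛ (1+X^ suc m · B≤ (suc m))) n
    ≡⟨ ⊛-congˡ (Π1+X^ 0 m) (1+X^-B≤ m 5∤) n ⟩
  (Π1+X^ 0 m ⊛ B≤ m) n ∎
  where open ≡-Reasoning

-- From 5 r to 5 r + 5, each of the four new parts prime to 5 multiplies one series by 1 + X^j and
-- divides the other by it. The part 5 r + 5 is forbidden in `B≤`, so its factor 1 + X^(5r+5)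
-- survives, which is 1 + X^(r+1) with X⁵ for X.
Π-B≤ : ∀ r → Π1+X^ 0 (5 * r) ⊛ B≤ (5 * r) ≗ spread₅ (Π1+X^ 0 r)
Π-B≤ zero n = trans (⊛-identityˡ (B≤ 0) n) (trans (B≤-0 n) (𝟙≗ n))
  where
  𝟙≗ : 𝟙 ≗ spread₅ 𝟙
  𝟙≗ 0 = refl
  𝟙≗ 1 = refl
  𝟙≗ 2 = refl
  𝟙≗ 3 = refl
  𝟙≗ 4 = refl
  𝟙≗ (suc (suc (suc (suc (suc n))))) = zeros n
    where
    zeros : ∀ n → false ≡ spread₅ (tail 𝟙) n
    zeros 0 = refl
    zeros 1 = refl
    zeros 2 = refl
    zeros 3 = refl
    zeros 4 = refl
    zeros (suc (suc (suc (suc (suc n))))) = zeros n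
Π-B≤ (suc r) n = begin
  (Π1+X^ 0 (5 * suc r) ⊛ B≤ (5 * suc r)) n
    ≡⟨ cong (λ k → (Π1+X^ 0 k ⊛ B≤ k) n) (*-suc 5 r) ⟩
  (Π1+X^ 0 (5 + m) ⊛ B≤ (5 + m)) n
    ≡⟨ 1+X^-⊛ˡ (5 + m) (Π1+X^ 0 (4 + m)) (B≤ (5 + m)) n ⟩
  (1+X^ (5 + m) · (Π1+X^ 0 (4 + m) ⊛ B≤ (5 + m))) n
    ≡⟨ 1+X^-cong (5 + m) (⊛-congˡ (Π1+X^ 0 (4 + m)) λ k →
         cong isOdd (b≤-∣ 5 (4 + m) (divides (suc r) (trans (sym (*-suc 5 r)) (*-comm 5 (suc r)))) k)) n ⟩
  (1+X^ (5 + m) · (Π1+X^ 0 (4 + m) ⊛ B≤ (4 + m))) n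
    ≡⟨ 1+X^-cong (5 + m) (λ k → trans (Π-B≤-∤ (3 + m) (5∤ 3 ≤-refl) k)
        (trans (Π-B≤-∤ (2 + m) (5∤ 2 (s≤s (s≤s (s≤s (s≤s z≤n))))) k)
        (trans (Π-B≤-∤ (1 + m) (5∤ 1 (s≤s (s≤s (s≤s z≤n)))) k)
        (trans (Π-B≤-∤ m (5∤ 0 (s≤s (s≤s z≤n))) k)
        (Π-B≤ r k))))) n ⟩
  (1+X^ (5 + m) · spread₅ (Π1+X^ 0 r)) n
    ≡⟨ cong (λ k → (1+X^ k · spread₅ (Π1+X^ 0 r)) n) (*-suc 5 r) ⟨
  (1+X^ (5 * suc r) · spread₅ (Π1+X^ 0 r)) n
    ≡⟨ spread₅-1+X^ (suc r) (Π1+X^ 0 r) n ⟨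
  spread₅ (Π1+X^ 0 (suc r)) n ∎
  where
  open ≡-Reasoning
  m = 5 * r
  5∤ : ∀ c → suc c < 5 → 5 ∤ suc c + m
  5∤ c 1+c<5 5∣ = >⇒∤ 1+c<5 (∣m+n∣m⇒∣n (subst (5 ∣_) (+-comm (suc c) m) 5∣) (m∣m*n r))

-- The pentagonal number theorem modulo 2

Square : ℕ → Set
Square N = ∃ λ x → x * x ≡ N

-- The bound on the root is what the induction over finite pentagonal sums moves: adding the
-- exponents for ± k raises it by 6.
squareBelow? : ∀ b N → Dec (∃ λ x → x < b × x * x ≡ N)
squareBelow? b N = anyUpTo? (λ x → x * x ≟ N) b

m≤m*m : ∀ m → m ≤ m * m
m≤m*m zero    = z≤n
m≤m*m (suc m) = m≤m+n (suc m) (m * suc m)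

square? : ∀ N → Dec (Square N)
square? N = map′ (λ { (x , _ , eq) → x , eq })
                 (λ { (x , eq) → x , s≤s (subst (x ≤_) eq (m≤m*m x)) , eq })
                 (squareBelow? (suc N) N)

*-self-injective : ∀ {x y} → x * x ≡ y * y → x ≡ y
*-self-injective {x} {y} eq with <-cmp x y
... | tri< x<y _ _ = contradiction eq (<⇒≢ (*-mono-< x<y x<y))
... | tri≈ _ x≡y _ = x≡y
... | tri> _ _ y<x = contradiction (sym eq) (<⇒≢ (*-mono-< y<x y<x))

-- Square roots in ℕ are unique, so the two alternatives exclude each other and `xor` expresses
-- their disjunction.
squareBelow?-suc : ∀ b N → does (squareBelow? (suc b) N) ≡ does (squareBelow? b N) xor does (b * b ≟ N)
squareBelow?-suc b N = go (b * b ≟ N)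
  where
  below : b * b ≢ N → (∃ λ x → x < suc b × x * x ≡ N) → ∃ λ x → x < b × x * x ≡ N
  below b*b≢N (x , x<1+b , eq) with m≤n⇒m<n∨m≡n (≤-pred x<1+b)
  ... | inj₁ x<b  = x , x<b , eq
  ... | inj₂ refl = contradiction eq b*b≢N
  go : Dec (b * b ≡ N) → does (squareBelow? (suc b) N) ≡ does (squareBelow? b N) xor does (b * b ≟ N)
  go (yes eq) = trans (dec-true (squareBelow? (suc b) N) (b , ≤-refl , eq))
    (sym (cong₂ _xor_ (dec-false (squareBelow? b N) λ (x , x<b , eq′) →
                         <-irrefl (*-self-injective (trans eq′ (sym eq))) x<b)
                      (dec-true (b * b ≟ N) eq)))
  go (no b*b≢N) = trans
    (does-⇔ (mk⇔ (below b*b≢N) (λ (x , x<b , eq) → x , m≤n⇒m≤1+n x<b , eq)) (squareBelow? (suc b) N) (squareBelow? b N))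
    (sym (trans (cong (does (squareBelow? b N) xor_) (dec-false (b * b ≟ N) b*b≢N)) (xor-identityʳ _)))

squareBelow?-square? : ∀ {b N} → N < b * b → does (squareBelow? b N) ≡ does (square? N)
squareBelow?-square? {b} {N} N<b*b = does-⇔
  (mk⇔ (λ { (x , _ , eq) → x , eq }) 
       (λ { (x , eq) → x , ≰⇒> (λ b≤x → <⇒≱ N<b*b (subst (b * b ≤_) eq (*-mono-≤ b≤x b≤x))) , eq }))
  (squareBelow? b N) (square? N)

-- The mod 2 reduction of ∏ (1 − X^ j) over j ≥ 1, by the pentagonal number theorem.
θ : Series
θ n = does (square? (24 * n + 1))

-- The definition appends the highest factor, whereas `term-split` has to restore the lowest one.
Π1+X^-suc : ∀ s l → Π1+X^ s (suc l) ≗ 1+X^ suc s · Π1+X^ (suc s) l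
Π1+X^-suc s zero    n = cong (λ k → (1+X^ suc k · 𝟙) n) (+-identityʳ s)
Π1+X^-suc s (suc l) n = begin
  (1+X^ suc (s + suc l) · Π1+X^ s (suc l)) n
    ≡⟨ 1+X^-cong (suc (s + suc l)) (Π1+X^-suc s l) n ⟩
  (1+X^ suc (s + suc l) · 1+X^ suc s · Π1+X^ (suc s) l) n
    ≡⟨ 1+X^-comm (suc (s + suc l)) (suc s) (Π1+X^ (suc s) l) n ⟩
  (1+X^ suc s · 1+X^ suc (s + suc l) · Π1+X^ (suc s) l) n
    ≡⟨ cong (λ k → (1+X^ suc s · 1+X^ suc k · Π1+X^ (suc s) l) n) (+-suc s l) ⟩
  (1+X^ suc s · Π1+X^ (suc s) (suc l)) n ∎
  where open ≡-Reasoning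

triangle : ℕ → ℕ
triangle zero    = zero
triangle (suc n) = suc n + triangle n

-- Shanks' finite form of the pentagonal number theorem: the sum over s ≤ n of
-- term n s is the sum of X^ (k (3k + 1) / 2) over |k| ≤ n. On passing from n to
-- n + 1 the terms change by consecutive carries, so the sum telescopes.
term : ℕ → ℕ → Series
term n s = X^ (s * n + triangle s) · Π1+X^ s (n ∸ s)

shanks : ℕ → ℕ → Series
shanks n zero    _ = false
shanks n (suc k)   = shanks n k ⊕ term n k

carry : ℕ → ℕ → Series
carry n zero    _ = false
carry n (suc s)   = X^ (suc s * suc n + triangle s) · Π1+X^ s (n ∸ s)

-- In characteristic 2, X^s = 1 + (1 + X^s). The summand 1 gives back the old term; the binomial is
-- the factor just below the product, and absorbing it yields the carry.
term-split : ∀ n s → s ≤ n → X^ (s * suc n + triangle s) · Π1+X^ s (n ∸ s) ≗ term n s ⊕ carry n s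
term-split n zero    _   m = sym (xor-identityʳ (Π1+X^ 0 n m))
term-split n (suc s) s<n m = begin
  (X^ (suc s * suc n + triangle (suc s)) · P) m
    ≡⟨ cong (λ k → (X^ k · P) m) (exponent s n (triangle s)) ⟩
  (X^ (E + suc s) · P) m
    ≡⟨ cong (λ f → f m) (X^-* E (suc s) P) ⟩
  (X^ E · X^ suc s · P) m
    ≡⟨ solve 2 (λ a b → b := a :+ (a :+ b)) refl ((X^ E · P) m) _ ⟩
  (X^ E · P) m xor ((X^ E · P) m xor (X^ E · X^ suc s · P) m)
    ≡⟨ cong ((X^ E · P) m xor_) (X^-⊕ E P (X^ suc s · P) m) ⟨
  (X^ E · P) m xor (X^ E · 1+X^ suc s · P) m
    ≡⟨ cong ((X^ E · P) m xor_) (X^-cong E (Π1+X^-suc s (n ∸ suc s)) m) ⟨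
  (X^ E · P) m xor (X^ E · Π1+X^ s (suc (n ∸ suc s))) m
    ≡⟨ cong ((X^ E · P) m xor_) (cong₂ (λ e l → (X^ e · Π1+X^ s l) m) (exponent′ s n (triangle s)) (sym (∸-suc s<n))) ⟩
  (X^ E · P) m xor carry n (suc s) m ∎
  where
  open ≡-Reasoning
  P = Π1+X^ (suc s) (n ∸ suc s)
  E = suc s * n + triangle (suc s)
  exponent : ∀ s n t → suc s * suc n + (suc s + t) ≡ suc s * n + (suc s + t) + suc s
  exponent = solve-∀
  exponent′ : ∀ s n t → suc s * n + (suc s + t) ≡ suc s * suc n + t
  exponent′ = solve-∀
  ∸-suc : ∀ {s n} → s < n → n ∸ s ≡ suc (n ∸ suc s)
  ∸-suc {zero}  {suc n} _         = refl
  ∸-suc {suc s} {suc n} (s≤s s<n) = ∸-suc s<n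

-- The product gains the factor 1 + X^(n+1): its summand 1 is treated by `term-split`, and its
-- summand X^(n+1) turns the exponent into that of the next carry.
term-suc : ∀ n s → s ≤ n → term (suc n) s ≗ term n s ⊕ carry n s ⊕ carry n (suc s)
term-suc n s s≤n m = begin
  (X^ E · Π1+X^ s (suc n ∸ s)) m
    ≡⟨ cong (λ l → (X^ E · Π1+X^ s l) m) (+-∸-assoc 1 s≤n) ⟩
  (X^ E · 1+X^ suc (s + (n ∸ s)) · P) m
    ≡⟨ cong (λ k → (X^ E · 1+X^ suc k · P) m) (m+[n∸m]≡n s≤n) ⟩
  (X^ E · 1+X^ suc n · P) m
    ≡⟨ X^-⊕ E P (X^ suc n · P) m ⟩
  (X^ E · P) m xor (X^ E · X^ suc n · P) m
    ≡⟨ cong₂ _xor_ (term-split n s s≤n m) (cong (λ f → f m) (sym (X^-* E (suc n) P))) ⟩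
  (term n s ⊕ carry n s) m xor (X^ (E + suc n) · P) m
    ≡⟨ cong (λ e → (term n s ⊕ carry n s) m xor (X^ e · P) m) (exponent s n (triangle s)) ⟩
  (term n s ⊕ carry n s ⊕ carry n (suc s)) m ∎
  where
  open ≡-Reasoning
  E = s * suc n + triangle s
  P = Π1+X^ s (n ∸ s)
  exponent : ∀ s n t → s * suc n + t + suc n ≡ suc s * suc n + t
  exponent = solve-∀

shanks-suc : ∀ n k → k ≤ suc n → shanks (suc n) k ≗ shanks n k ⊕ carry n k
shanks-suc n zero    _         m = refl
shanks-suc n (suc k) (s≤s k≤n) m = trans
  (cong₂ _xor_ (shanks-suc n k (m≤n⇒m≤1+n k≤n) m) (term-suc n k k≤n m))
  (solve 4 (λ a b c d → (a :+ b) :+ ((c :+ b) :+ d) := (a :+ c) :+ d) refl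
    (shanks n k m) (carry n k m) (term n k m) (carry n (suc k) m))

X^-𝟙 : ∀ k m → (X^ k · 𝟙) m ≡ does (k ≟ m)
X^-𝟙 zero    zero    = refl
X^-𝟙 zero    (suc m) = refl
X^-𝟙 (suc k) zero    = refl
X^-𝟙 (suc k) (suc m) = X^-𝟙 k m

triangle-double : ∀ n → triangle n * 2 ≡ n * suc n
triangle-double zero    = refl
triangle-double (suc n) = trans (*-distribʳ-+ 2 (suc n) (triangle n))
  (trans (cong (λ k → suc n * 2 + k) (triangle-double n)) (lemma n))
  where
  lemma : ∀ n → suc n * 2 + n * suc n ≡ suc n * suc (suc n)
  lemma = solve-∀

∣⇒x*x≢24n+1 : ∀ {d x} n → 1 < d → d ∣ 24 → d ∣ x → x * x ≢ 24 * n + 1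
∣⇒x*x≢24n+1 {d} {x} n 1<d d∣24 d∣x eq =
  >⇒∤ 1<d (∣m+n∣m⇒∣n (subst (d ∣_) eq (∣m⇒∣m*n x d∣x)) (∣m⇒∣m*n n d∣24))

-- With k = n + 1, the step adds two monomials, the last carry and the new last term, of exponents
-- `ω₁` = k (3k - 1) / 2 and `ω₂` = k (3k + 1) / 2. The bound passes the six candidates 6n + 2, ...,
-- 6n + 7, of which only 6k - 1 and 6k + 1 are prime to 6, and their squares are 24 `ω₁` + 1 and 24
-- `ω₂` + 1.
shanks-pentagonal : ∀ n m → shanks n (suc n) m ≡ does (squareBelow? (n * 6 + 2) (24 * m + 1))
shanks-pentagonal zero zero    = refl
shanks-pentagonal zero (suc m) = sym (dec-false (squareBelow? 2 (24 * suc m + 1)) λ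
  { (0 , _ , eq) → contradiction (trans eq (+-comm (24 * suc m) 1)) (λ ())
  ; (1 , _ , eq) → contradiction (suc-injective (trans eq (+-comm (24 * suc m) 1))) (λ ())
  ; (suc (suc _) , s≤s (s≤s ()) , _)
  })
shanks-pentagonal (suc n) m = begin
  shanks (suc n) (suc n) m xor term (suc n) (suc n) m
    ≡⟨ cong (_xor term (suc n) (suc n) m) (shanks-suc n (suc n) ≤-refl m) ⟩
  (shanks n (suc n) m xor carry n (suc n) m) xor term (suc n) (suc n) m
    ≡⟨ cong₂ (λ e f → (shanks n (suc n) m xor e) xor f)
         (trans (cong (λ l → (X^ (suc n * suc n + triangle n) · Π1+X^ n l) m) (n∸n≡0 n)) (X^-𝟙 ω₁ m))
         (trans (cong (λ l → (X^ (suc n * suc n + triangle (suc n)) · Π1+X^ (suc n) l) m) (n∸n≡0 n)) (X^-𝟙 ω₂ m)) ⟩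
  (shanks n (suc n) m xor does (ω₁ ≟ m)) xor does (ω₂ ≟ m)
    ≡⟨ cong₂ _xor_ (cong₂ _xor_ (shanks-pentagonal n m) (hit (3 + c₀) ω₁ root₁)) (hit (5 + c₀) ω₂ root₂) ⟩
  (below c₀ xor root (3 + c₀)) xor root (5 + c₀)
    ≡⟨ cong (λ e → (e xor root (3 + c₀)) xor root (5 + c₀)) (sym (trans (miss two (2 + c₀) (divides (3 * n + 2) (e₂ n)))
        (trans (miss three (1 + c₀) (divides (2 * n + 1) (e₁ n))) (miss two c₀ (divides (3 * n + 1) (e₀ n)))))) ⟩
  (below (3 + c₀) xor root (3 + c₀)) xor root (5 + c₀)
    ≡⟨ cong (_xor root (5 + c₀)) (sym (trans (miss two (4 + c₀) (divides (3 * n + 3) (e₄ n)))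
                                           (squareBelow?-suc (3 + c₀) (24 * m + 1)))) ⟩
  below (5 + c₀) xor root (5 + c₀)
    ≡⟨ squareBelow?-suc (5 + c₀) (24 * m + 1) ⟨
  below (6 + c₀) ∎
  where
  open ≡-Reasoning
  c₀ = n * 6 + 2
  ω₁ = suc n * suc n + triangle n
  ω₂ = suc n * suc n + triangle (suc n)
  below root : ℕ → Bool
  below c = does (squareBelow? c (24 * m + 1))
  root c  = does (c * c ≟ 24 * m + 1)
  two : 1 < 2 × 2 ∣ 24
  two = s≤s (s≤s z≤n) , divides 12 refl
  three : 1 < 3 × 3 ∣ 24
  three = s≤s (s≤s z≤n) , divides 8 refl
  miss : ∀ {d} → 1 < d × d ∣ 24 → ∀ c → d ∣ c → below (suc c) ≡ below c
  miss (1<d , d∣24) c d∣c = trans (squareBelow?-suc c (24 * m + 1))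
    (trans (cong (below c xor_) (dec-false (c * c ≟ 24 * m + 1) (∣⇒x*x≢24n+1 m 1<d d∣24 d∣c)))
           (xor-identityʳ (below c)))
  e₀ : ∀ n → n * 6 + 2 ≡ (3 * n + 1) * 2
  e₀ = solve-∀
  e₁ : ∀ n → 1 + (n * 6 + 2) ≡ (2 * n + 1) * 3
  e₁ = solve-∀
  e₂ : ∀ n → 2 + (n * 6 + 2) ≡ (3 * n + 2) * 2
  e₂ = solve-∀
  e₄ : ∀ n → 4 + (n * 6 + 2) ≡ (3 * n + 3) * 2
  e₄ = solve-∀
  hit : ∀ c ω → c * c ≡ 24 * ω + 1 → does (ω ≟ m) ≡ root c
  hit c ω eq = does-⇔ (mk⇔ (λ { refl → eq })
    (λ eq′ → *-cancelˡ-≡ ω m 24 (+-cancelʳ-≡ 1 _ _ (trans (sym eq) eq′)))) (ω ≟ m) (c * c ≟ 24 * m + 1)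
  root₁ : (3 + c₀) * (3 + c₀) ≡ 24 * ω₁ + 1
  root₁ = trans (lemma n) (trans (cong (λ t → 24 * (suc n * suc n) + 12 * t + 1) (sym (triangle-double n)))
    (lemma′ (suc n * suc n) (triangle n)))
    where
    lemma : ∀ n → (3 + (n * 6 + 2)) * (3 + (n * 6 + 2)) ≡ 24 * (suc n * suc n) + 12 * (n * suc n) + 1
    lemma = solve-∀
    lemma′ : ∀ s t → 24 * s + 12 * (t * 2) + 1 ≡ 24 * (s + t) + 1
    lemma′ = solve-∀
  root₂ : (5 + c₀) * (5 + c₀) ≡ 24 * ω₂ + 1
  root₂ = trans (lemma n) (trans (cong (λ t → 24 * (suc n * suc n) + 12 * t + 1) (sym (triangle-double (suc n))))
    (lemma′ (suc n * suc n) (triangle (suc n))))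
    where
    lemma : ∀ n → (5 + (n * 6 + 2)) * (5 + (n * 6 + 2)) ≡ 24 * (suc n * suc n) + 12 * (suc n * suc (suc n)) + 1
    lemma = solve-∀
    lemma′ : ∀ s t → 24 * s + 12 * (t * 2) + 1 ≡ 24 * (s + t) + 1
    lemma′ = solve-∀

-- A term with s ≥ 1 begins in degree s n + s (s + 1) / 2 > n, so up to degree n only `term n 0`,
-- the full product, is seen.
shanks-Π : ∀ n k {m} → m ≤ n → shanks n (suc k) m ≡ Π1+X^ 0 n m
shanks-Π n zero        m≤n = refl
shanks-Π n (suc k) {m} m≤n = trans
  (cong₂ _xor_ (shanks-Π n k m≤n) (X^-< (suc k * n + triangle (suc k)) (Π1+X^ (suc k) (n ∸ suc k)) m<))
  (xor-identityʳ _)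
  where
  m< : m < suc k * n + triangle (suc k)
  m< = ≤-trans (s≤s m≤n) (subst (suc n ≤_) (lemma n k (triangle k)) (m≤m+n (suc n) _))
    where
    lemma : ∀ n k t → suc n + (k * n + k + t) ≡ suc k * n + (suc k + t)
    lemma = solve-∀

-- Since (6n + 2)² > 24m + 1 for m ≤ n, the bounded search for a root misses nothing.
Π1+X^≡θ : ∀ n {m} → m ≤ n → Π1+X^ 0 n m ≡ θ m
Π1+X^≡θ n {m} m≤n = trans (sym (shanks-Π n n m≤n)) (trans (shanks-pentagonal n m)
  (squareBelow?-square? {n * 6 + 2} (≤-<-trans (+-monoˡ-≤ 1 (*-monoʳ-≤ 24 m≤n))
    (subst (24 * n + 1 <_) (lemma n) (m≤m+n (suc (24 * n + 1)) _)))))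
  where
  lemma : ∀ n → suc (24 * n + 1) + (36 * (n * n) + 2) ≡ (n * 6 + 2) * (n * 6 + 2)
  lemma = solve-∀

-- For the coefficient at `n`, parts are cut off at 5 n: this is at least `n`, and `Π-B≤` works with
-- multiples of 5.
θ-⊛-B : θ ⊛ B ≗ spread₅ θ
θ-⊛-B n = begin
  (θ ⊛ B) n
    ≡⟨ ⊛-cong-≤ n (λ i i≤n → sym (Π1+X^≡θ (5 * n) (≤-trans i≤n n≤5n)))
                  (λ i i≤n → sym (B≤-stable (≤-trans i≤n n≤5n))) ⟩
  (Π1+X^ 0 (5 * n) ⊛ B≤ (5 * n)) n
    ≡⟨ Π-B≤ n n ⟩
  spread₅ (Π1+X^ 0 n) n
    ≡⟨ spread₅-cong-≤ n (λ i i≤n → Π1+X^≡θ n i≤n) ⟩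
  spread₅ θ n ∎
  where
  open ≡-Reasoning
  n≤5n : n ≤ 5 * n
  n≤5n = m≤n*m n 5

-- Parity of finite sets

-- Injectivity is asked for on the list only, because `toSolution` below takes a point and its
-- reflection to the same pair.
unique-map⁺ : {A B : Set} (f : A → B) {xs : List A} →
  (∀ {x y} → x ∈ xs → y ∈ xs → f x ≡ f y → x ≡ y) → Unique xs → Unique (map f xs)
unique-map⁺ f inj []         = []
unique-map⁺ f inj (x∉ ∷ uxs) =
  All.map⁺ (All.tabulate λ y∈ fx≡fy → All.lookup x∉ y∈ (inj (here refl) (there y∈) fx≡fy))
  ∷ unique-map⁺ f (λ x∈ y∈ → inj (there x∈) (there y∈)) uxs

length-bijection : {A B : Set} (f : A → B) {xs : List A} {ys : List B} → Unique xs → Unique ys →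
  (∀ {x y} → x ∈ xs → y ∈ xs → f x ≡ f y → x ≡ y) →
  (∀ {x} → x ∈ xs → f x ∈ ys) → (∀ {y} → y ∈ ys → ∃ λ x → x ∈ xs × f x ≡ y) →
  length xs ≡ length ys
length-bijection f {xs} uxs uys inj to onto = trans (sym (length-map f xs))
  (↭-length (∼bag⇒↭ (unique∧set⇒bag (unique-map⁺ f inj uxs) uys
    (mk⇔ (λ y∈ → let x , x∈ , y≡ = ∈-map⁻ f y∈ in subst (_∈ _) (sym y≡) (to x∈))
         (λ y∈ → let x , x∈ , fx≡y = onto y∈ in subst (_∈ _) fx≡y (∈-map⁺ f x∈))))))

isOdd-subsingleton : {A : Set} {xs : List A} {c : Bool} → Unique xs → (∀ {x y} → x ∈ xs → y ∈ xs → x ≡ y) →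
  (∀ {x} → x ∈ xs → c ≡ true) → (c ≡ true → ∃ λ x → x ∈ xs) → isOdd (length xs) ≡ c
isOdd-subsingleton {xs = []}         {true}  _ _ _ from with () ← proj₂ (from refl)
isOdd-subsingleton {xs = []}         {false} _ _ _ _    = refl
isOdd-subsingleton {xs = x ∷ []}     _ _ to _ = sym (to (here refl))
isOdd-subsingleton {xs = x ∷ y ∷ xs} ((x≢y ∷ _) ∷ _) prop _ _ =
  contradiction (prop (here refl) (there (here refl))) x≢y

module _ {A : Set} (_≟_ : DecidableEquality A) (f : A → A) where

  private
    fixed? : ∀ x → Dec (f x ≡ x)
    fixed? x = f x ≟ x

    Involutive : List A → Set
    Involutive xs = (∀ {x} → x ∈ xs → f x ∈ xs) × (∀ {x} → x ∈ xs → f (f x) ≡ x)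

    -- A fixed head is counted on both sides; a moved head is deleted together with its image, which
    -- changes the length by two. The list left over is not a sublist tail, so the recursion runs on
    -- the length bound `k`.
    go : ∀ k xs → length xs ≤ k → Unique xs → Involutive xs →
         isOdd (length xs) ≡ isOdd (length (filter fixed? xs))
    go k       []       _          _                  _            = refl
    go (suc k) (x ∷ xs) (s≤s |xs|≤k) (x∉xs ∷ uxs) (closed , inv) with f x ≟ x
    ... | yes fx≡x = cong not (go k xs |xs|≤k uxs (closed′ , λ z∈ → inv (there z∈)))
      where
      closed′ : ∀ {z} → z ∈ xs → f z ∈ xs
      closed′ {z} z∈ with closed (there z∈)
      ... | there fz∈ = fz∈
      ... | here fz≡x = contradiction
        (trans (sym fx≡x) (trans (cong f (sym fz≡x)) (inv (there z∈))))
        (All.lookup x∉xs z∈)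
    ... | no fx≢x with closed (here refl)
    ... | here fx≡x = contradiction fx≡x fx≢x
    ... | there fx∈ with as , bs , refl ← ∈-∃++ fx∈ = begin
      not (isOdd (length (as ++ f x ∷ bs)))
        ≡⟨ cong (λ l → not (isOdd l)) (↭-length perm) ⟩
      not (not (isOdd (length (as ++ bs))))
        ≡⟨ not-involutive _ ⟩
      isOdd (length (as ++ bs))
        ≡⟨ go k (as ++ bs) (≤-trans (n≤1+n _) (≤-trans (≤-reflexive (sym (↭-length perm))) |xs|≤k)) uys
             (closed′ , λ z∈ → inv (there (∈ys⇒∈xs z∈))) ⟩
      isOdd (length (filter fixed? (as ++ bs)))
        ≡⟨ cong (λ l → isOdd (length l)) (filter-reject fixed? λ ffx≡fx → fx≢x (trans (sym ffx≡fx) (inv (here refl)))) ⟨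
      isOdd (length (filter fixed? (f x ∷ as ++ bs)))
        ≡⟨ cong isOdd (↭-length (filter-↭ fixed? perm)) ⟨
      isOdd (length (filter fixed? (as ++ f x ∷ bs))) ∎
      where
      open ≡-Reasoning
      perm : as ++ f x ∷ bs ↭ f x ∷ as ++ bs
      perm = shift (f x) as bs
      unique : Unique (f x ∷ as ++ bs)
      unique = ↭ₛ.Unique-resp-↭ (setoid A) (↭⇒↭ₛ perm) uxs
      uys : Unique (as ++ bs)
      uys with _ ∷ u ← unique = u
      fx∉ : All (f x ≢_) (as ++ bs)
      fx∉ with u ∷ _ ← unique = u
      ∈ys⇒∈xs : ∀ {z} → z ∈ as ++ bs → z ∈ as ++ f x ∷ bs
      ∈ys⇒∈xs z∈ = ∈-resp-↭ (↭-sym perm) (there z∈)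
      closed′ : ∀ {z} → z ∈ as ++ bs → f z ∈ as ++ bs
      closed′ {z} z∈ with closed (there (∈ys⇒∈xs z∈))
      ... | here fz≡x = contradiction (trans (sym (cong f fz≡x)) (inv (there (∈ys⇒∈xs z∈)))) (All.lookup fx∉ z∈)
      ... | there fz∈ with ∈-resp-↭ perm fz∈
      ... | there fz∈ys = fz∈ys
      ... | here fz≡fx  = contradiction
        (trans (sym (inv (here refl))) (trans (cong f (sym fz≡fx)) (inv (there (∈ys⇒∈xs z∈)))))
        (All.lookup x∉xs (∈ys⇒∈xs z∈))

  isOdd-involution : ∀ {xs} → Unique xs → (∀ {x} → x ∈ xs → f x ∈ xs) → (∀ {x} → x ∈ xs → f (f x) ≡ x) →
                     isOdd (length xs) ≡ isOdd (length (filter (λ x → f x ≟ x) xs))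
  isOdd-involution {xs} uxs closed inv = go (length xs) xs ≤-refl uxs (closed , inv)

-- Coefficients of a product as parities of sets of pairs

consIf : {A : Set} → Bool → A → List A → List A
consIf true  x xs = x ∷ xs
consIf false x xs = xs

-- The list follows the recursion of `⊛`, so the parity of its length is the coefficient by
-- construction.
solutions : Series → Series → ℕ → List (ℕ × ℕ)
solutions f g zero    = consIf (f 0 ∧ g 0) (0 , 0) []
solutions f g (suc n) = consIf (f 0 ∧ g (suc n)) (0 , suc n) (map (map₁ suc) (solutions (tail f) g n))

isOdd-consIf : {A : Set} → ∀ c (x : A) xs → isOdd (length (consIf c x xs)) ≡ c xor isOdd (length xs)
isOdd-consIf true  x xs = refl
isOdd-consIf false x xs = refl

isOdd-solutions : ∀ f g n → isOdd (length (solutions f g n)) ≡ (f ⊛ g) n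
isOdd-solutions f g zero    with f 0 ∧ g 0
... | true  = refl
... | false = refl
isOdd-solutions f g (suc n) = trans (isOdd-consIf (f 0 ∧ g (suc n)) _ _)
  (cong ((f 0 ∧ g (suc n)) xor_) (trans (cong isOdd (length-map _ (solutions (tail f) g n)))
                                        (isOdd-solutions (tail f) g n)))

Solution : Series → Series → ℕ → ℕ × ℕ → Set
Solution f g n (i , j) = i + j ≡ n × f i ≡ true × g j ≡ true

∈-consIf⁻ : {A : Set} → ∀ c {x z : A} {xs} → z ∈ consIf c x xs → (c ≡ true × z ≡ x) ⊎ z ∈ xs
∈-consIf⁻ true  (here z≡x) = inj₁ (refl , z≡x)
∈-consIf⁻ true  (there z∈) = inj₂ z∈
∈-consIf⁻ false z∈         = inj₂ z∈

∈-consIf⁺ˡ : {A : Set} → ∀ {c} {x : A} {xs} → c ≡ true → x ∈ consIf c x xs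
∈-consIf⁺ˡ refl = here refl

∈-consIf⁺ʳ : {A : Set} → ∀ c {x z : A} {xs} → z ∈ xs → z ∈ consIf c x xs
∈-consIf⁺ʳ true  z∈ = there z∈
∈-consIf⁺ʳ false z∈ = z∈

unique-consIf : {A : Set} → ∀ c {x : A} {xs} → x ∉ xs → Unique xs → Unique (consIf c x xs)
unique-consIf true  x∉ u = All.tabulate (λ z∈ x≡z → x∉ (subst (_∈ _) (sym x≡z) z∈)) ∷ u
unique-consIf false x∉ u = u

∧-true⁻ : ∀ {a b} → a ∧ b ≡ true → a ≡ true × b ≡ true
∧-true⁻ {true} {true} _ = refl , refl

∈-solutions⁻ : ∀ f g n {z} → z ∈ solutions f g n → Solution f g n z
∈-solutions⁻ f g zero z∈ with ∈-consIf⁻ (f 0 ∧ g 0) z∈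
... | inj₁ (eq , refl) = refl , ∧-true⁻ eq
∈-solutions⁻ f g (suc n) z∈ with ∈-consIf⁻ (f 0 ∧ g (suc n)) z∈
... | inj₁ (eq , refl) = refl , ∧-true⁻ eq
... | inj₂ z∈′ with (i , j) , ij∈ , refl ← ∈-map⁻ (map₁ suc) z∈′
               with eq , fi , gj ← ∈-solutions⁻ (tail f) g n ij∈ = cong suc eq , fi , gj

∈-solutions⁺ : ∀ f g n {z} → Solution f g n z → z ∈ solutions f g n
∈-solutions⁺ f g zero    {zero , .0}       (refl , f0 , g0) = ∈-consIf⁺ˡ (cong₂ _∧_ f0 g0)
∈-solutions⁺ f g (suc n) {zero , .(suc n)} (refl , f0 , gn) = ∈-consIf⁺ˡ (cong₂ _∧_ f0 gn)
∈-solutions⁺ f g (suc n) {suc i , j}       (eq , fi , gj)   =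
  ∈-consIf⁺ʳ (f 0 ∧ g (suc n)) (∈-map⁺ (map₁ suc) (∈-solutions⁺ (tail f) g n (suc-injective eq , fi , gj)))

unique-solutions : ∀ f g n → Unique (solutions f g n)
unique-solutions f g zero    = unique-consIf (f 0 ∧ g 0) (λ ()) []
unique-solutions f g (suc n) = unique-consIf (f 0 ∧ g (suc n))
  (λ z∈ → case-∈ (∈-map⁻ (map₁ suc) z∈))
  (unique-map⁺ (map₁ suc) (λ { _ _ refl → refl }) (unique-solutions (tail f) g n))
  where
  case-∈ : ¬ (∃ λ z → z ∈ solutions (tail f) g n × (0 , suc n) ≡ map₁ suc z)
  case-∈ ((_ , _) , _ , ())

-- Squares modulo 24

integers≤ : ℕ → List ℤ
integers≤ b = map +_ (upTo (suc b)) ++ map -[1+_] (upTo b)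

∈-integers≤ : ∀ {b} i → ∣ i ∣ ≤ b → i ∈ integers≤ b
∈-integers≤     (+ n)    n≤b = ∈-++⁺ˡ (∈-map⁺ +_ (∈-upTo⁺ (s≤s n≤b)))
∈-integers≤ {b} -[1+ n ] n<b = ∈-++⁺ʳ (map +_ (upTo (suc b))) (∈-map⁺ -[1+_] (∈-upTo⁺ n<b))

unique-integers≤ : ∀ b → Unique (integers≤ b)
unique-integers≤ b = Unique.++⁺ (Unique.map⁺ ℤ.+-injective (Unique.upTo⁺ (suc b)))
  (Unique.map⁺ ℤ.-[1+-injective (Unique.upTo⁺ b)) disjoint
  where
  disjoint : ∀ {i} → ¬ (i ∈ map +_ (upTo (suc b)) × i ∈ map -[1+_] (upTo b))
  disjoint (i∈ , i∈′) with _ , _ , refl ← ∈-map⁻ +_ i∈ with _ , _ , () ← ∈-map⁻ -[1+_] i∈′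

i*i≡+∣i∣*∣i∣ : ∀ i → i ℤ.* i ≡ + (∣ i ∣ * ∣ i ∣)
i*i≡+∣i∣*∣i∣ (+ n)    = sym (ℤ.pos-* n n)
i*i≡+∣i∣*∣i∣ -[1+ n ] = refl

∣i∣≡∣j∣⇒i≡j⊎i≡-j : ∀ {i j} → ∣ i ∣ ≡ ∣ j ∣ → i ≡ j ⊎ i ≡ - j
∣i∣≡∣j∣⇒i≡j⊎i≡-j {+ _}      {+ _}      refl = inj₁ refl
∣i∣≡∣j∣⇒i≡j⊎i≡-j {+ _}      { -[1+ _ ]} refl = inj₂ refl
∣i∣≡∣j∣⇒i≡j⊎i≡-j { -[1+ _ ]} {+ _}      refl = inj₂ refl
∣i∣≡∣j∣⇒i≡j⊎i≡-j { -[1+ _ ]} { -[1+ _ ]} refl = inj₁ refl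

-i≡i⇒i≡0 : ∀ {i} → - i ≡ i → i ≡ + 0
-i≡i⇒i≡0 {+ zero} _ = refl

odd-square : ∀ {y} → 2 ∤ y → ∃ λ t → y * y ≡ 8 * t + 1
odd-square {y} 2∤y with y % 2 | m%n<n y 2 | m≡m%n+[m/n]*n y 2 | m%n≡0⇒n∣m y 2
... | 0 | _ | _  | even = contradiction (even refl) 2∤y
... | 1 | _ | eq | _    = triangle (y / 2) , (begin
  y * y                          ≡⟨ cong₂ _*_ eq eq ⟩
  (1 + y / 2 * 2) * (1 + y / 2 * 2) ≡⟨ lemma (y / 2) ⟩
  4 * (y / 2 * suc (y / 2)) + 1  ≡⟨ cong (λ s → 4 * s + 1) (triangle-double (y / 2)) ⟨
  4 * (triangle (y / 2) * 2) + 1 ≡⟨ lemma′ (triangle (y / 2)) ⟩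
  8 * triangle (y / 2) + 1       ∎)
  where
  open ≡-Reasoning
  lemma : ∀ w → (1 + w * 2) * (1 + w * 2) ≡ 4 * (w * suc w) + 1
  lemma = solve-∀
  lemma′ : ∀ t → 4 * (t * 2) + 1 ≡ 8 * t + 1
  lemma′ = solve-∀
... | suc (suc _) | s≤s (s≤s ()) | _ | _

coprime-square-residue : ∀ (r : Fin 24) → toℕ r % 2 ≢ 0 → toℕ r % 3 ≢ 0 → toℕ r * toℕ r % 24 ≡ 1
coprime-square-residue = from-yes (all? λ (r : Fin 24) →
  ¬? (toℕ r % 2 ≟ 0) →-dec (¬? (toℕ r % 3 ≟ 0) →-dec (toℕ r * toℕ r % 24 ≟ 1)))

coprime-square : ∀ {x} → 2 ∤ x → 3 ∤ x → ∃ λ i → x * x ≡ 24 * i + 1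
coprime-square {x} 2∤x 3∤x = x * x / 24 , trans (m≡m%n+[m/n]*n (x * x) 24)
  (trans (cong₂ _+_ residue (*-comm (x * x / 24) 24)) (+-comm 1 (24 * (x * x / 24))))
  where
  r : Fin 24
  r = fromℕ< (m%n<n x 24)
  r≡ : toℕ r ≡ x % 24
  r≡ = toℕ-fromℕ< (m%n<n x 24)
  coprime : ∀ d .{{_ : NonZero d}} → d ∣ 24 → d ∤ x → toℕ r % d ≢ 0
  coprime d d∣24 d∤x eq = d∤x (m%n≡0⇒n∣m x d
    (trans (sym (m∣n⇒o%n%m≡o%m d 24 x d∣24)) (trans (cong (_% d) (sym r≡)) eq)))
  residue : x * x % 24 ≡ 1
  residue = trans (%-distribˡ-* x x 24) (trans (cong (λ s → s * s % 24) (sym r≡))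
    (coprime-square-residue r (coprime 2 (divides 12 refl) 2∤x) (coprime 3 (divides 8 refl) 3∤x)))

square-coprime : ∀ {x i} d → 1 < d → d ∣ 24 → x * x ≡ 24 * i + 1 → d ∤ x
square-coprime {i = i} d 1<d d∣24 eq d∣x = ∣⇒x*x≢24n+1 i 1<d d∣24 d∣x eq

residue-mod-6 : ∀ {x} → 2 ∤ x → 3 ∤ x → ∃ λ a → + x ≡ + 1 ℤ.+ + 6 ℤ.* a ⊎ + x ≡ - (+ 1) ℤ.+ + 6 ℤ.* a
residue-mod-6 {x} 2∤x 3∤x = go (x % 6) (x / 6) (m%n<n x 6) (m≡m%n+[m/n]*n x 6)
  where
  cast : ∀ {r} q → x ≡ r + q * 6 → + x ≡ + r ℤ.+ + q ℤ.* + 6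
  cast {r} q eq = trans (cong +_ eq) (cong (λ z → + r ℤ.+ z) (ℤ.pos-* q 6))
  l₀ : ∀ q → q * 6 ≡ q * 3 * 2
  l₀ = solve-∀
  l₁ : ∀ q → + 1 ℤ.+ q ℤ.* + 6 ≡ + 1 ℤ.+ + 6 ℤ.* q
  l₁ = ℤ.solve-∀
  l₂ : ∀ q → 2 + q * 6 ≡ (1 + q * 3) * 2
  l₂ = solve-∀
  l₃ : ∀ q → 3 + q * 6 ≡ (1 + q * 2) * 3
  l₃ = solve-∀
  l₄ : ∀ q → 4 + q * 6 ≡ (2 + q * 3) * 2
  l₄ = solve-∀
  l₅ : ∀ q → + 5 ℤ.+ q ℤ.* + 6 ≡ - (+ 1) ℤ.+ + 6 ℤ.* (+ 1 ℤ.+ q)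
  l₅ = ℤ.solve-∀
  go : ∀ r q → r < 6 → x ≡ r + q * 6 → ∃ λ a → + x ≡ + 1 ℤ.+ + 6 ℤ.* a ⊎ + x ≡ - (+ 1) ℤ.+ + 6 ℤ.* a
  go 0 q _ eq = contradiction (divides (q * 3) (trans eq (l₀ q))) 2∤x
  go 1 q _ eq = + q , inj₁ (trans (cast q eq) (l₁ (+ q)))
  go 2 q _ eq = contradiction (divides (1 + q * 3) (trans eq (l₂ q))) 2∤x
  go 3 q _ eq = contradiction (divides (1 + q * 2) (trans eq (l₃ q))) 3∤x
  go 4 q _ eq = contradiction (divides (2 + q * 3) (trans eq (l₄ q))) 2∤x
  go 5 q _ eq = + 1 ℤ.+ + q , inj₂ (trans (cast q eq) (l₅ (+ q)))
  go (suc (suc (suc (suc (suc (suc r)))))) _ (s≤s (s≤s (s≤s (s≤s (s≤s (s≤s ())))))) _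

-- Both numbers are ±1 modulo 6, so x or -x is congruent to y; `v` is the sixth part of the
-- difference. This turns a pair of roots into a point of the form.
sign-mod-6 : ∀ {x y} → 2 ∤ x → 3 ∤ x → 2 ∤ y → 3 ∤ y → ∃ λ v → ∣ + y ℤ.- + 6 ℤ.* v ∣ ≡ x
sign-mod-6 {x} {y} 2∤x 3∤x 2∤y 3∤y = combine (residue-mod-6 2∤x 3∤x) (residue-mod-6 2∤y 3∤y)
  where
  same : ∀ ε a b → + x ≡ ε ℤ.+ + 6 ℤ.* a → + y ≡ ε ℤ.+ + 6 ℤ.* b → ∣ + y ℤ.- + 6 ℤ.* (b ℤ.- a) ∣ ≡ x
  same ε a b x≡ y≡ = cong ∣_∣ (trans (cong (ℤ._- + 6 ℤ.* (b ℤ.- a)) y≡) (trans (l ε a b) (sym x≡)))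
    where
    l : ∀ ε a b → ε ℤ.+ + 6 ℤ.* b ℤ.- + 6 ℤ.* (b ℤ.- a) ≡ ε ℤ.+ + 6 ℤ.* a
    l = ℤ.solve-∀
  opposite : ∀ ε a b → + x ≡ ε ℤ.+ + 6 ℤ.* a → + y ≡ - ε ℤ.+ + 6 ℤ.* b → ∣ + y ℤ.- + 6 ℤ.* (b ℤ.+ a) ∣ ≡ x
  opposite ε a b x≡ y≡ = trans
    (cong ∣_∣ (trans (cong (ℤ._- + 6 ℤ.* (b ℤ.+ a)) y≡) (trans (l ε a b) (cong -_ (sym x≡)))))
    (ℤ.∣-i∣≡∣i∣ (+ x))
    where
    l : ∀ ε a b → - ε ℤ.+ + 6 ℤ.* b ℤ.- + 6 ℤ.* (b ℤ.+ a) ≡ - (ε ℤ.+ + 6 ℤ.* a)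
    l = ℤ.solve-∀
  combine : (∃ λ a → + x ≡ + 1 ℤ.+ + 6 ℤ.* a ⊎ + x ≡ - (+ 1) ℤ.+ + 6 ℤ.* a) →
            (∃ λ b → + y ≡ + 1 ℤ.+ + 6 ℤ.* b ⊎ + y ≡ - (+ 1) ℤ.+ + 6 ℤ.* b) →
            ∃ λ v → ∣ + y ℤ.- + 6 ℤ.* v ∣ ≡ x
  combine (a , inj₁ x≡) (b , inj₁ y≡) = b ℤ.- a , same (+ 1) a b x≡ y≡
  combine (a , inj₂ x≡) (b , inj₂ y≡) = b ℤ.- a , same (- (+ 1)) a b x≡ y≡
  combine (a , inj₁ x≡) (b , inj₂ y≡) = b ℤ.+ a , opposite (+ 1) a b x≡ y≡
  combine (a , inj₂ x≡) (b , inj₁ y≡) = b ℤ.+ a , opposite (- (+ 1)) a b x≡ y≡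

-- Points of the quadratic form

-- Characterising f(X^d) by its support lets the argument on points treat `spread₂` and `spread₅` at
-- once.
SpreadBy : ℕ → Series → Series → Set
SpreadBy d f g = ∀ k → g k ≡ true ⇔ ∃ λ j → k ≡ d * j × f j ≡ true

does-true⁻ : {A : Set} (a? : Dec A) → does a? ≡ true → A
does-true⁻ (yes a) _ = a

θ-true⁻ : ∀ {n} → θ n ≡ true → Square (24 * n + 1)
θ-true⁻ {n} = does-true⁻ (square? (24 * n + 1))

-- The representative of ± (y , v) whose first coordinate is a natural number.
normalise : ℤ → ℤ → ℕ × ℤ
normalise (+ y)    v = y , v
normalise -[1+ y ] v = suc y , - v

normalise-neg : ∀ {y} v → y ≢ + 0 → normalise (- y) (- v) ≡ normalise y v
normalise-neg {+ zero}    v y≢0 = contradiction refl y≢0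
normalise-neg {+ suc y}   v y≢0 = cong (suc y ,_) (ℤ.neg-involutive v)
normalise-neg { -[1+ y ]} v y≢0 = refl

normalise-≡ : ∀ a {b y v} → normalise a b ≡ (y , v) → (a ≡ + y × b ≡ v) ⊎ (a ≡ - (+ y) × b ≡ - v)
normalise-≡ (+ _)        refl = inj₁ (refl , refl)
normalise-≡ -[1+ _ ] {b} refl = inj₂ (refl , sym (ℤ.neg-involutive b))

-- This is ((y - 6v)² + d y²) / (1 + d) with the division carried out by means of e (1 + d) = 6;
-- `form-scaled` multiplies it back.
form : ℤ → ℤ → ℤ → ℤ
form e y v = y ℤ.* y ℤ.- + 2 ℤ.* (e ℤ.* y ℤ.* v) ℤ.+ + 6 ℤ.* (e ℤ.* v ℤ.* v)

form-neg : ∀ e y v → form e (- y) (- v) ≡ form e y v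
form-neg = lemma
  where
  lemma : ∀ e y v → (- y) ℤ.* (- y) ℤ.- + 2 ℤ.* (e ℤ.* (- y) ℤ.* (- v)) ℤ.+ + 6 ℤ.* (e ℤ.* (- v) ℤ.* (- v))
                  ≡ y ℤ.* y ℤ.- + 2 ℤ.* (e ℤ.* y ℤ.* v) ℤ.+ + 6 ℤ.* (e ℤ.* v ℤ.* v)
  lemma = ℤ.solve-∀

-- For fixed v the form is a monic quadratic in y, and two arguments with the same value sum to 2 e
-- v. The map exchanges them, up to a common sign of both coordinates.
form-conjugate : ∀ e y v → form e (y ℤ.- + 2 ℤ.* (e ℤ.* v)) (- v) ≡ form e y v
form-conjugate = lemma
  where
  lemma : ∀ e y v → (y ℤ.- + 2 ℤ.* (e ℤ.* v)) ℤ.* (y ℤ.- + 2 ℤ.* (e ℤ.* v))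
                    ℤ.- + 2 ℤ.* (e ℤ.* (y ℤ.- + 2 ℤ.* (e ℤ.* v)) ℤ.* (- v)) ℤ.+ + 6 ℤ.* (e ℤ.* (- v) ℤ.* (- v))
                  ≡ y ℤ.* y ℤ.- + 2 ℤ.* (e ℤ.* y ℤ.* v) ℤ.+ + 6 ℤ.* (e ℤ.* v ℤ.* v)
  lemma = ℤ.solve-∀

-- For fixed y, two values of v with the same value of the form sum to y / 3, an integer only when 3
-- ∣ y; hence the case distinction in `reflectIf`.
form-reflect : ∀ e w v → form e (w ℤ.* + 3) (w ℤ.- v) ≡ form e (w ℤ.* + 3) v
form-reflect = lemma
  where
  lemma : ∀ e w v → (w ℤ.* + 3) ℤ.* (w ℤ.* + 3)
                    ℤ.- + 2 ℤ.* (e ℤ.* (w ℤ.* + 3) ℤ.* (w ℤ.- v)) ℤ.+ + 6 ℤ.* (e ℤ.* (w ℤ.- v) ℤ.* (w ℤ.- v))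
                  ≡ (w ℤ.* + 3) ℤ.* (w ℤ.* + 3) ℤ.- + 2 ℤ.* (e ℤ.* (w ℤ.* + 3) ℤ.* v) ℤ.+ + 6 ℤ.* (e ℤ.* v ℤ.* v)
  lemma = ℤ.solve-∀

form-scaled : ∀ e d y v → e ℤ.* (+ 1 ℤ.+ d) ≡ + 6 →
  (y ℤ.- + 6 ℤ.* v) ℤ.* (y ℤ.- + 6 ℤ.* v) ℤ.+ d ℤ.* (y ℤ.* y) ≡ (+ 1 ℤ.+ d) ℤ.* form e y v
form-scaled e d y v e*[1+d]≡6 = trans (expand d y v)
  (trans (cong (λ s → (+ 1 ℤ.+ d) ℤ.* (y ℤ.* y) ℤ.- + 2 ℤ.* s ℤ.* (y ℤ.* v) ℤ.+ + 6 ℤ.* s ℤ.* (v ℤ.* v))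
               (sym e*[1+d]≡6))
         (collect e d y v))
  where
  expand : ∀ d y v → (y ℤ.- + 6 ℤ.* v) ℤ.* (y ℤ.- + 6 ℤ.* v) ℤ.+ d ℤ.* (y ℤ.* y)
         ≡ (+ 1 ℤ.+ d) ℤ.* (y ℤ.* y) ℤ.- + 2 ℤ.* + 6 ℤ.* (y ℤ.* v) ℤ.+ + 6 ℤ.* + 6 ℤ.* (v ℤ.* v)
  expand = ℤ.solve-∀
  collect : ∀ e d y v →
      (+ 1 ℤ.+ d) ℤ.* (y ℤ.* y) ℤ.- + 2 ℤ.* (e ℤ.* (+ 1 ℤ.+ d)) ℤ.* (y ℤ.* v)
        ℤ.+ + 6 ℤ.* (e ℤ.* (+ 1 ℤ.+ d)) ℤ.* (v ℤ.* v)
    ≡ (+ 1 ℤ.+ d) ℤ.* (y ℤ.* y ℤ.- + 2 ℤ.* (e ℤ.* y ℤ.* v) ℤ.+ + 6 ℤ.* (e ℤ.* v ℤ.* v))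
  collect = ℤ.solve-∀

form-even : ∀ e w v → form e (w ℤ.* + 2) v
  ≡ + 2 ℤ.* (+ 2 ℤ.* (w ℤ.* w) ℤ.- + 2 ℤ.* (e ℤ.* w ℤ.* v) ℤ.+ + 3 ℤ.* (e ℤ.* v ℤ.* v))
form-even = lemma
  where
  lemma : ∀ e w v → (w ℤ.* + 2) ℤ.* (w ℤ.* + 2) ℤ.- + 2 ℤ.* (e ℤ.* (w ℤ.* + 2) ℤ.* v) ℤ.+ + 6 ℤ.* (e ℤ.* v ℤ.* v)
    ≡ + 2 ℤ.* (+ 2 ℤ.* (w ℤ.* w) ℤ.- + 2 ℤ.* (e ℤ.* w ℤ.* v) ℤ.+ + 3 ℤ.* (e ℤ.* v ℤ.* v))
  lemma = ℤ.solve-∀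

abstract
  -- The exponent at which a root x contributes to `θ`; meaningful for x prime to 6, where the
  -- division is exact.
  index : ℕ → ℕ
  index x = (x * x ∸ 1) / 24

  index-unique : ∀ {x i} → x * x ≡ 24 * i + 1 → index x ≡ i
  index-unique {x} {i} eq = trans (cong (λ s → (s ∸ 1) / 24) eq)
    (trans (cong (_/ 24) (trans (m+n∸n≡m (24 * i) 1) (*-comm 24 i))) (m*n/n≡m i 24))

  index-square : ∀ {x} → 2 ∤ x → 3 ∤ x → x * x ≡ 24 * index x + 1
  index-square {x} 2∤x 3∤x with i , eq ← coprime-square 2∤x 3∤x =
    trans eq (cong (λ i → 24 * i + 1) (sym (index-unique {x} {i} eq)))

-- For x = y − 6 v and e (1 + d) = 6 the equation form e y v = 4 e n + 1 becomes
-- x² + d y² = 24 n + 1 + d.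
module Points (d e n : ℕ) .{{_ : NonZero d}} (e*[1+d]≡6 : e * suc d ≡ 6) where

  M : ℕ
  M = 4 * e * n + 1

  record Point (z : ℕ × ℤ) : Set where
    constructor onForm
    field
      form≡M : form (+ e) (+ proj₁ z) (proj₂ z) ≡ + M

  point? : ∀ z → Dec (Point z)
  point? (y , v) = map′ onForm Point.form≡M (form (+ e) (+ y) v ℤ.≟ + M)

  private
    root : ℕ × ℤ → ℕ
    root (y , v) = ∣ + y ℤ.- + 6 ℤ.* v ∣

    E[1+D]≡6 : + e ℤ.* (+ 1 ℤ.+ + d) ≡ + 6
    E[1+D]≡6 = trans (sym (ℤ.pos-* e (suc d))) (cong +_ e*[1+d]≡6)

  root-form : ∀ y v → + (root (y , v) * root (y , v) + d * (y * y)) ≡ + suc d ℤ.* form (+ e) (+ y) v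
  root-form y v = begin
    + (root (y , v) * root (y , v)) ℤ.+ + (d * (y * y))
      ≡⟨ cong₂ ℤ._+_ (sym (i*i≡+∣i∣*∣i∣ (+ y ℤ.- + 6 ℤ.* v)))
          (trans (ℤ.pos-* d (y * y)) (cong (+ d ℤ.*_) (ℤ.pos-* y y))) ⟩
    (+ y ℤ.- + 6 ℤ.* v) ℤ.* (+ y ℤ.- + 6 ℤ.* v) ℤ.+ + d ℤ.* (+ y ℤ.* + y)
      ≡⟨ form-scaled (+ e) (+ d) (+ y) v E[1+D]≡6 ⟩
    + suc d ℤ.* form (+ e) (+ y) v ∎
    where open ≡-Reasoning

  point⇒root : ∀ {y v} → Point (y , v) → root (y , v) * root (y , v) + d * (y * y) ≡ suc d * M
  point⇒root {y} {v} (onForm P) = ℤ.+-injective (trans (root-form y v)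
    (trans (cong (+ suc d ℤ.*_) P) (sym (ℤ.pos-* (suc d) M))))

  root⇒point : ∀ y v → root (y , v) * root (y , v) + d * (y * y) ≡ suc d * M → Point (y , v)
  root⇒point y v eq = onForm (ℤ.*-cancelˡ-≡ (+ suc d) _ (+ M)
    (trans (sym (root-form y v)) (trans (cong +_ eq) (ℤ.pos-* (suc d) M))))

  [1+d]*M : suc d * M ≡ 24 * n + suc d
  [1+d]*M = trans (lemma e (suc d) n) (cong (λ s → 4 * s * n + suc d) e*[1+d]≡6)
    where
    lemma : ∀ e c n → c * (4 * e * n + 1) ≡ 4 * (e * c) * n + c
    lemma = solve-∀

  M-odd : 2 ∤ M
  M-odd 2∣M = >⇒∤ (s≤s (s≤s z≤n)) (∣m+n∣m⇒∣n 2∣M (divides (2 * e * n) (lemma e n)))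
    where
    lemma : ∀ e n → 4 * e * n ≡ 2 * e * n * 2
    lemma = solve-∀

  -- Modulo 2 the form is y², and `M` is odd.
  point-odd : ∀ {y v} → Point (y , v) → 2 ∤ y
  point-odd {v = v} (onForm P) (divides w refl) = M-odd (divides ∣ r ∣
    (trans (cong ∣_∣ (trans (sym P) (trans (cong (λ y → form (+ e) y v) (ℤ.pos-* w 2)) (form-even (+ e) (+ w) v))))
    (trans (ℤ.abs-* (+ 2) r) (*-comm 2 ∣ r ∣))))
    where r = + 2 ℤ.* (+ w ℤ.* + w) ℤ.- + 2 ℤ.* (+ e ℤ.* + w ℤ.* v) ℤ.+ + 3 ℤ.* (+ e ℤ.* v ℤ.* v)

  private
    box : List (ℕ × ℤ)
    box = cartesianProduct (upTo (suc (suc d * M))) (integers≤ (suc d * M + suc d * M))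

  points : List (ℕ × ℤ)
  points = filter point? box

  unique-points : Unique points
  unique-points = Unique.filter⁺ point?
    (Unique.cartesianProduct⁺ (Unique.upTo⁺ (suc (suc d * M))) (unique-integers≤ (suc d * M + suc d * M)))

  ∈-points⁻ : ∀ {z} → z ∈ points → Point z
  ∈-points⁻ z∈ = proj₂ (∈-filter⁻ point? {xs = box} z∈)

  -- As d ≥ 1, the form x² + d y² is positive definite, so x and y are at most (1 + d) `M` in
  -- absolute value; v is then bounded through 6 v = y - x.
  ∈-points⁺ : ∀ {z} → Point z → z ∈ points
  ∈-points⁺ {y , v} P = ∈-filter⁺ point?
    (∈-cartesianProduct⁺ (∈-upTo⁺ (s≤s y≤)) (∈-integers≤ v v≤)) P
    where
    y≤ : y ≤ suc d * M
    y≤ = begin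
      y                ≤⟨ m≤m*m y ⟩
      y * y            ≤⟨ m≤n*m (y * y) d ⟩
      d * (y * y)      ≤⟨ m≤n+m (d * (y * y)) (root (y , v) * root (y , v)) ⟩
      root (y , v) * root (y , v) + d * (y * y) ≡⟨ point⇒root P ⟩
      suc d * M        ∎
      where open ≤-Reasoning
    root≤ : root (y , v) ≤ suc d * M
    root≤ = begin
      root (y , v) ≤⟨ m≤m*m (root (y , v)) ⟩
      root (y , v) * root (y , v) ≤⟨ m≤m+n _ (d * (y * y)) ⟩
      root (y , v) * root (y , v) + d * (y * y) ≡⟨ point⇒root P ⟩
      suc d * M ∎
      where open ≤-Reasoning
    6v : ∀ y v → + 6 ℤ.* v ≡ y ℤ.- (y ℤ.- + 6 ℤ.* v)
    6v = ℤ.solve-∀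
    v≤ : ∣ v ∣ ≤ suc d * M + suc d * M
    v≤ = begin
      ∣ v ∣ ≤⟨ m≤n*m ∣ v ∣ 6 ⟩
      6 * ∣ v ∣ ≡⟨ ℤ.abs-* (+ 6) v ⟨
      ∣ + 6 ℤ.* v ∣ ≡⟨ cong ∣_∣ (6v (+ y) v) ⟩
      ∣ + y ℤ.- (+ y ℤ.- + 6 ℤ.* v) ∣ ≤⟨ ℤ.∣i-j∣≤∣i∣+∣j∣ (+ y) (+ y ℤ.- + 6 ℤ.* v) ⟩
      y + root (y , v) ≤⟨ +-mono-≤ y≤ root≤ ⟩
      suc d * M + suc d * M ∎
      where open ≤-Reasoning

  _≟×_ : DecidableEquality (ℕ × ℤ)
  _≟×_ = ≡-dec _≟_ ℤ._≟_

  -- A point (y , v) stands for u + e v √−d with u = y − e v, up to sign.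
  -- Here conjugate is complex conjugation, and reflect negates x = y − 6 v,
  -- keeping y, whenever 3 ∣ y makes x divisible by 3 as well.
  conjugateℤ : ℤ → ℤ → ℕ × ℤ
  conjugateℤ y v = normalise (y ℤ.- + 2 ℤ.* (+ e ℤ.* v)) (- v)

  conjugate : ℕ × ℤ → ℕ × ℤ
  conjugate (y , v) = conjugateℤ (+ y) v

  normalise-point : ∀ a b → form (+ e) a b ≡ + M → Point (normalise a b)
  normalise-point (+ _)    b P = onForm P
  normalise-point -[1+ y ] b P = onForm (trans (form-neg (+ e) -[1+ y ] b) P)

  conjugate-closed : ∀ {z} → Point z → Point (conjugate z)
  conjugate-closed {y , v} (onForm P) = normalise-point _ (- v) (trans (form-conjugate (+ e) (+ y) v) P)

  conjugate-normalise : ∀ a b → a ℤ.- + 2 ℤ.* (+ e ℤ.* b) ≢ + 0 → conjugate (normalise a b) ≡ conjugateℤ a b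
  conjugate-normalise (+ _)    b ≢0 = refl
  conjugate-normalise -[1+ y ] b ≢0 = trans
    (cong (λ a → normalise a (- (- b))) (lemma (+ e) -[1+ y ] b)) (normalise-neg (- b) ≢0)
    where
    lemma : ∀ e a b → - a ℤ.- + 2 ℤ.* (e ℤ.* (- b)) ≡ - (a ℤ.- + 2 ℤ.* (e ℤ.* b))
    lemma = ℤ.solve-∀

  -- The choice of sign in `normalise` is ambiguous only at first coordinate 0; parity excludes it.
  point-≢0 : ∀ {y v} → Point (y , v) → + y ≢ + 0
  point-≢0 P refl = point-odd P (divides 0 refl)

  conjugate-involutive : ∀ {z} → Point z → conjugate (conjugate z) ≡ z
  conjugate-involutive {y , v} P = trans
    (conjugate-normalise (+ y ℤ.- + 2 ℤ.* (+ e ℤ.* v)) (- v) (λ eq → point-≢0 P (trans (sym (lemma (+ e) (+ y) v)) eq)))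
    (cong₂ normalise (lemma (+ e) (+ y) v) (ℤ.neg-involutive v))
    where
    lemma : ∀ e y v → y ℤ.- + 2 ℤ.* (e ℤ.* v) ℤ.- + 2 ℤ.* (e ℤ.* (- v)) ≡ y
    lemma = ℤ.solve-∀

  -- Up to sign, a number equals its conjugate only if it is real, v = 0, or purely imaginary, u = y
  -- - e v = 0.
  conjugate-fixed⁻ : ∀ {y v} → conjugate (y , v) ≡ (y , v) → v ≡ + 0 ⊎ + y ≡ + e ℤ.* v
  conjugate-fixed⁻ {y} {v} fixed with normalise-≡ (+ y ℤ.- + 2 ℤ.* (+ e ℤ.* v)) fixed
  ... | inj₁ (_ , -v≡v) = inj₁ (-i≡i⇒i≡0 -v≡v)
  ... | inj₂ (eq , _)   = inj₂ (ℤ.*-cancelˡ-≡ (+ 2) (+ y) (+ e ℤ.* v)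
    (trans (l₁ (+ y) (+ e ℤ.* v)) (trans (cong (λ z → z ℤ.+ + y ℤ.+ + 2 ℤ.* (+ e ℤ.* v)) eq) (l₂ (+ y) (+ e ℤ.* v)))))
    where
    l₁ : ∀ y s → + 2 ℤ.* y ≡ y ℤ.- + 2 ℤ.* s ℤ.+ y ℤ.+ + 2 ℤ.* s
    l₁ = ℤ.solve-∀
    l₂ : ∀ y s → - y ℤ.+ y ℤ.+ + 2 ℤ.* s ≡ + 2 ℤ.* s
    l₂ = ℤ.solve-∀

  conjugate-fixed⁺ : ∀ {y v} → Point (y , v) → v ≡ + 0 ⊎ + y ≡ + e ℤ.* v → conjugate (y , v) ≡ (y , v)
  conjugate-fixed⁺ {y} P (inj₁ refl) = cong (λ a → normalise a (+ 0)) (lemma (+ e) (+ y))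
    where
    lemma : ∀ e y → y ℤ.- + 2 ℤ.* (e ℤ.* + 0) ≡ y
    lemma = ℤ.solve-∀
  conjugate-fixed⁺ {y} {v} P (inj₂ eq) = trans
    (cong (λ a → normalise a (- v)) (trans (cong (λ s → + y ℤ.- + 2 ℤ.* s) (sym eq)) (lemma (+ y))))
    (normalise-neg v (point-≢0 P))
    where
    lemma : ∀ y → y ℤ.- + 2 ℤ.* y ≡ - y
    lemma = ℤ.solve-∀

  reflectIf : ∀ {y} → Dec (3 ∣ y) → ℤ → ℤ
  reflectIf (yes (divides w _)) v = + w ℤ.- v
  reflectIf (no _)              v = v

  reflect : ℕ × ℤ → ℕ × ℤ
  reflect (y , v) = y , reflectIf (3 ∣? y) v

  reflect-closed : ∀ {z} → Point z → Point (reflect z)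
  reflect-closed {y , v} (onForm P) with 3 ∣? y
  ... | no _                  = onForm P
  ... | yes (divides w y≡w*3) = onForm (trans (cong (λ y → form (+ e) y (+ w ℤ.- v)) y≡)
    (trans (form-reflect (+ e) (+ w) v) (trans (cong (λ y → form (+ e) y v) (sym y≡)) P)))
    where
    y≡ : + y ≡ + w ℤ.* + 3
    y≡ = trans (cong +_ y≡w*3) (ℤ.pos-* w 3)

  reflect-involutive : ∀ z → reflect (reflect z) ≡ z
  reflect-involutive (y , v) = cong (y ,_) (involutive (3 ∣? y))
    where
    lemma : ∀ w v → w ℤ.- (w ℤ.- v) ≡ v
    lemma = ℤ.solve-∀
    involutive : ∀ d → reflectIf {y} d (reflectIf d v) ≡ v
    involutive (yes (divides w _)) = lemma (+ w) v
    involutive (no _)              = refl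

  -- If y = 3 w, being fixed means w = 2 v, so y would be even.
  reflect-fixed⁻ : ∀ {y v} → Point (y , v) → reflect (y , v) ≡ (y , v) → 3 ∤ y
  reflect-fixed⁻ {y} {v} P fixed with 3 ∣? y
  ... | no 3∤y                = 3∤y
  ... | yes (divides w y≡w*3) = contradiction
    (divides (∣ v ∣ * 3) (trans y≡w*3 (trans (cong (_* 3) w≡) (lemma′ ∣ v ∣)))) (point-odd P)
    where
    lemma : ∀ w v → w ≡ w ℤ.- v ℤ.+ v
    lemma = ℤ.solve-∀
    double-v : ∀ v → v ℤ.+ v ≡ + 2 ℤ.* v
    double-v = ℤ.solve-∀
    w≡ : w ≡ 2 * ∣ v ∣
    w≡ = trans (cong ∣_∣ (trans (lemma (+ w) v) (trans (cong (λ z → proj₂ z ℤ.+ v) fixed) (double-v v))))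
               (ℤ.abs-* (+ 2) v)
    lemma′ : ∀ a → 2 * a * 3 ≡ a * 3 * 2
    lemma′ = solve-∀

  reflect-fixed⁺ : ∀ {y v} → 3 ∤ y → reflect (y , v) ≡ (y , v)
  reflect-fixed⁺ {y} 3∤y with 3 ∣? y
  ... | yes 3∣y = contradiction 3∣y 3∤y
  ... | no _    = refl

  conjugateFixed reflectFixed : List (ℕ × ℤ)
  conjugateFixed = filter (λ z → conjugate z ≟× z) points
  reflectFixed   = filter (λ z → reflect z ≟× z) points

  conjugateFixed≡reflectFixed : isOdd (length reflectFixed) ≡ isOdd (length conjugateFixed)
  conjugateFixed≡reflectFixed = trans
    (sym (isOdd-involution _≟×_ reflect unique-points
      (λ z∈ → ∈-points⁺ (reflect-closed (∈-points⁻ z∈))) (λ {z} _ → reflect-involutive z)))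
    (isOdd-involution _≟×_ conjugate unique-points
      (λ z∈ → ∈-points⁺ (conjugate-closed (∈-points⁻ z∈))) (λ z∈ → conjugate-involutive (∈-points⁻ z∈)))

  root-coprime : ∀ c → c ∣ 6 → ∀ {y v} → c ∤ y → c ∤ root (y , v)
  root-coprime c (divides q 6≡q*c) {y} {v} c∤y c∣x = c∤y (ℤ.∣⇒∣ᵤ {+ c} {+ y}
    (subst (+ c ℤ.∣_) (lemma (+ y) v) (ℤ.∣m∣n⇒∣m+n (ℤ.∣ᵤ⇒∣ {+ c} {+ y ℤ.- + 6 ℤ.* v} c∣x)
      (ℤ.∣m⇒∣m*n v (ℤ.∣ᵤ⇒∣ {+ c} {+ 6} (divides q 6≡q*c))))))
    where
    lemma : ∀ y v → y ℤ.- + 6 ℤ.* v ℤ.+ + 6 ℤ.* v ≡ y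
    lemma = ℤ.solve-∀

  module _ {g : Series} (g-spread : SpreadBy d θ g) where

    private
      toSolution : ℕ × ℤ → ℕ × ℕ
      toSolution z = index (root z) , d * index (proj₁ z)

      record CoprimeTo3 (z : ℕ × ℤ) : Set where
        constructor coprimeTo3
        field
          point : Point z
          3∤    : 3 ∤ proj₁ z
        x-index : root z * root z ≡ 24 * index (root z) + 1
        x-index = index-square (root-coprime 2 (divides 3 refl) {v = proj₂ z} (point-odd point))
                               (root-coprime 3 (divides 2 refl) {v = proj₂ z} 3∤)
        y-index : proj₁ z * proj₁ z ≡ 24 * index (proj₁ z) + 1
        y-index = index-square (point-odd point) 3∤

      open CoprimeTo3

      ∈-reflectFixed⁻ : ∀ {z} → z ∈ reflectFixed → CoprimeTo3 z
      ∈-reflectFixed⁻ {z} z∈ with z∈′ , fixed ← ∈-filter⁻ (λ z → reflect z ≟× z) {xs = points} z∈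
        = coprimeTo3 (∈-points⁻ z∈′) (reflect-fixed⁻ (∈-points⁻ z∈′) fixed)

      ∈-reflectFixed⁺ : ∀ {z} → CoprimeTo3 z → z ∈ reflectFixed
      ∈-reflectFixed⁺ {z} (coprimeTo3 P 3∤y) =
        ∈-filter⁺ (λ z → reflect z ≟× z) (∈-points⁺ P) (reflect-fixed⁺ {proj₁ z} {proj₂ z} 3∤y)

      to : ∀ {z} → z ∈ reflectFixed → toSolution z ∈ solutions θ g n
      to {z@(y , v)} z∈ = ∈-solutions⁺ θ g n
        ( *-cancelˡ-≡ _ n 24 (+-cancelʳ-≡ (suc d) _ _ (trans (lemma (index (root z)) (index y) d)
            (trans (cong₂ (λ s t → s + d * t) (sym (x-index c)) (sym (y-index c)))
            (trans (point⇒root (point c)) [1+d]*M))))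
        , dec-true (square? (24 * index (root z) + 1)) (root z , x-index c)
        , Equivalence.from (g-spread _) (index y , refl , dec-true (square? (24 * index y + 1)) (y , y-index c)))
        where
        c = ∈-reflectFixed⁻ z∈
        lemma : ∀ i j d → 24 * (i + d * j) + suc d ≡ 24 * i + 1 + d * (24 * j + 1)
        lemma = solve-∀

      -- Equal indices determine y and the absolute value of x = y - 6 v. Opposite signs of x would
      -- give 2 y = 6 (v + v′), hence 3 ∣ y.
      injective : ∀ {z z′} → z ∈ reflectFixed → z′ ∈ reflectFixed → toSolution z ≡ toSolution z′ → z ≡ z′
      injective {z@(y , v)} {z′@(y′ , v′)} z∈ z′∈ eq = go y≡y′
        where
        c  = ∈-reflectFixed⁻ z∈
        c′ = ∈-reflectFixed⁻ z′∈
        x≡x′ : root z ≡ root z′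
        x≡x′ = *-self-injective (trans (x-index c) (trans (cong (λ i → 24 * proj₁ i + 1) eq) (sym (x-index c′))))
        y≡y′ : y ≡ y′
        y≡y′ = *-self-injective (trans (y-index c) (trans
          (cong (λ j → 24 * j + 1) (*-cancelˡ-≡ (index y) (index y′) d (cong proj₂ eq))) (sym (y-index c′))))
        l₁ : ∀ y v → + 6 ℤ.* v ≡ y ℤ.- (y ℤ.- + 6 ℤ.* v)
        l₁ = ℤ.solve-∀
        l₂ : ∀ y v → + 2 ℤ.* y ≡ y ℤ.- + 6 ℤ.* v ℤ.+ (y ℤ.+ + 6 ℤ.* v)
        l₂ = ℤ.solve-∀
        l₃ : ∀ y v v′ → - (y ℤ.- + 6 ℤ.* v′) ℤ.+ (y ℤ.+ + 6 ℤ.* v) ≡ + 2 ℤ.* ((v ℤ.+ v′) ℤ.* + 3)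
        l₃ = ℤ.solve-∀
        go : y ≡ y′ → z ≡ z′
        go refl = [ same , opposite ]′ (∣i∣≡∣j∣⇒i≡j⊎i≡-j x≡x′)
          where
          same : + y ℤ.- + 6 ℤ.* v ≡ + y ℤ.- + 6 ℤ.* v′ → z ≡ z′
          same eq = cong (y ,_) (ℤ.*-cancelˡ-≡ (+ 6) v v′
            (trans (l₁ (+ y) v) (trans (cong (λ x → + y ℤ.- x) eq) (sym (l₁ (+ y) v′)))))
          opposite : + y ℤ.- + 6 ℤ.* v ≡ - (+ y ℤ.- + 6 ℤ.* v′) → z ≡ z′
          opposite eq = contradiction (divides ∣ v ℤ.+ v′ ∣ (trans
            (cong ∣_∣ (ℤ.*-cancelˡ-≡ (+ 2) (+ y) ((v ℤ.+ v′) ℤ.* + 3)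
              (trans (l₂ (+ y) v) (trans (cong (ℤ._+ (+ y ℤ.+ + 6 ℤ.* v)) eq) (l₃ (+ y) v v′)))))
            (ℤ.abs-* (v ℤ.+ v′) (+ 3)))) (3∤ c)

      fromSolution : ∀ {i j x y} → i + d * j ≡ n → x * x ≡ 24 * i + 1 → y * y ≡ 24 * j + 1 →
                     (∃ λ v → root (y , v) ≡ x) → ∃ λ z → z ∈ reflectFixed × toSolution z ≡ (i , d * j)
      fromSolution {i} {j} {x} {y} i+dj≡n x²≡ y²≡ (v , root≡x) =
        (y , v)
        , ∈-reflectFixed⁺ (coprimeTo3 (root⇒point y v norm)
            (square-coprime {y} {j} 3 (s≤s (s≤s z≤n)) (divides 8 refl) y²≡))
        , cong₂ (λ a b → a , d * b) (index-unique root²≡) (index-unique y²≡)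
        where
        root²≡ : root (y , v) * root (y , v) ≡ 24 * i + 1
        root²≡ = trans (cong (λ r → r * r) root≡x) x²≡
        lemma : ∀ i j d → 24 * i + 1 + d * (24 * j + 1) ≡ 24 * (i + d * j) + suc d
        lemma = solve-∀
        norm : root (y , v) * root (y , v) + d * (y * y) ≡ suc d * M
        norm = trans (cong₂ (λ s t → s + d * t) root²≡ y²≡)
          (trans (lemma i j d) (trans (cong (λ s → 24 * s + suc d) i+dj≡n) (sym [1+d]*M)))

      onto : ∀ {s} → s ∈ solutions θ g n → ∃ λ z → z ∈ reflectFixed × toSolution z ≡ s
      onto {i , k} s∈ = go (∈-solutions⁻ θ g n s∈)
        where
        go : Solution θ g n (i , k) → ∃ λ z → z ∈ reflectFixed × toSolution z ≡ (i , k)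
        go (i+k≡n , θi , gk) with j , refl , θj ← Equivalence.to (g-spread k) gk =
          fromSolution {i} {j} {proj₁ sq-i} {proj₁ sq-j} i+k≡n (proj₂ sq-i) (proj₂ sq-j)
            (sign-mod-6 (∤₂ {i = i} (proj₂ sq-i)) (∤₃ {i = i} (proj₂ sq-i))
                        (∤₂ {i = j} (proj₂ sq-j)) (∤₃ {i = j} (proj₂ sq-j)))
          where
          sq-i : Square (24 * i + 1)
          sq-i = θ-true⁻ {i} θi
          sq-j : Square (24 * j + 1)
          sq-j = θ-true⁻ {j} θj
          ∤₂ : ∀ {x i} → x * x ≡ 24 * i + 1 → 2 ∤ x
          ∤₂ {x} {i} = square-coprime {x} {i} 2 (s≤s (s≤s z≤n)) (divides 12 refl)
          ∤₃ : ∀ {x i} → x * x ≡ 24 * i + 1 → 3 ∤ x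
          ∤₃ {x} {i} = square-coprime {x} {i} 3 (s≤s (s≤s z≤n)) (divides 8 refl)

    θ-⊛-spread : (θ ⊛ g) n ≡ isOdd (length conjugateFixed)
    θ-⊛-spread = begin
      (θ ⊛ g) n                          ≡⟨ isOdd-solutions θ g n ⟨
      isOdd (length (solutions θ g n))   ≡⟨ cong isOdd (length-bijection toSolution
                                              (Unique.filter⁺ (λ z → reflect z ≟× z) unique-points)
                                              (unique-solutions θ g n) injective to onto) ⟨
      isOdd (length reflectFixed)        ≡⟨ conjugateFixed≡reflectFixed ⟩
      isOdd (length conjugateFixed)      ∎
      where open ≡-Reasoning

-- The subseries of index 4 n + 1

spread₂-* : ∀ f j → spread₂ f (2 * j) ≡ f j
spread₂-* f zero    = refl
spread₂-* f (suc j) = trans (cong (spread₂ f) (*-suc 2 j)) (spread₂-* (tail f) j)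

spread₂-spread : ∀ f → SpreadBy 2 f (spread₂ f)
spread₂-spread f k = mk⇔ (to f k) (λ { (j , refl , fj) → trans (spread₂-* f j) fj })
  where
  to : ∀ f k → spread₂ f k ≡ true → ∃ λ j → k ≡ 2 * j × f j ≡ true
  to f zero          f0 = 0 , refl , f0
  to f (suc (suc k)) eq with j , refl , fj ← to (tail f) k eq = suc j , sym (*-suc 2 j) , fj

spread₅-* : ∀ f j → spread₅ f (5 * j) ≡ f j
spread₅-* f zero    = refl
spread₅-* f (suc j) = trans (cong (spread₅ f) (*-suc 5 j)) (spread₅-* (tail f) j)

spread₅-spread : ∀ f → SpreadBy 5 f (spread₅ f)
spread₅-spread f k = mk⇔ (to f k) (λ { (j , refl , fj) → trans (spread₅-* f j) fj })
  where
  to : ∀ f k → spread₅ f k ≡ true → ∃ λ j → k ≡ 5 * j × f j ≡ true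
  to f zero f0 = 0 , refl , f0
  to f (suc (suc (suc (suc (suc k))))) eq with j , refl , fj ← to (tail f) k eq = suc j , sym (*-suc 5 j) , fj

form-0 : ∀ e y → form e y (+ 0) ≡ y ℤ.* y
form-0 = lemma
  where
  lemma : ∀ e y → y ℤ.* y ℤ.- + 2 ℤ.* (e ℤ.* y ℤ.* + 0) ℤ.+ + 6 ℤ.* (e ℤ.* + 0 ℤ.* + 0) ≡ y ℤ.* y
  lemma = ℤ.solve-∀

form-1-diagonal : ∀ y → form (+ 1) y y ≡ + 5 ℤ.* (y ℤ.* y)
form-1-diagonal = lemma
  where
  lemma : ∀ y → y ℤ.* y ℤ.- + 2 ℤ.* (+ 1 ℤ.* y ℤ.* y) ℤ.+ + 6 ℤ.* (+ 1 ℤ.* y ℤ.* y) ≡ + 5 ℤ.* (y ℤ.* y)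
  lemma = ℤ.solve-∀

module _ (d e n : ℕ) .{{_ : NonZero d}} (e*[1+d]≡6 : e * suc d ≡ 6) where
  open Points d e n e*[1+d]≡6

  unique-conjugateFixed : Unique conjugateFixed
  unique-conjugateFixed = Unique.filter⁺ (λ z → conjugate z ≟× z) unique-points

  ∈-conjugateFixed⁻ : ∀ {y v} → (y , v) ∈ conjugateFixed → Point (y , v) × (v ≡ + 0 ⊎ + y ≡ + e ℤ.* v)
  ∈-conjugateFixed⁻ z∈ with z∈′ , fixed ← ∈-filter⁻ (λ z → conjugate z ≟× z) {xs = points} z∈ =
    ∈-points⁻ z∈′ , conjugate-fixed⁻ fixed

  ∈-conjugateFixed⁺ : ∀ {y v} → Point (y , v) → v ≡ + 0 ⊎ + y ≡ + e ℤ.* v → (y , v) ∈ conjugateFixed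
  ∈-conjugateFixed⁺ {y} {v} P fixed =
    ∈-filter⁺ (λ z → conjugate z ≟× z) (∈-points⁺ P) (conjugate-fixed⁺ P fixed)

  point-0⁻ : ∀ {y} → Point (y , + 0) → y * y ≡ M
  point-0⁻ {y} (onForm P) = ℤ.+-injective (trans (ℤ.pos-* y y) (trans (sym (form-0 (+ e) (+ y))) P))

  point-0⁺ : ∀ {y} → y * y ≡ M → Point (y , + 0)
  point-0⁺ {y} eq = onForm (trans (form-0 (+ e) (+ y)) (trans (sym (ℤ.pos-* y y)) (cong +_ eq)))

  -- With the imaginary axis excluded by assumption, only points (y , 0) with y² = `M` remain, and
  -- there is at most one.
  isOdd-conjugateFixed-0 : ∀ N → N ≡ M → (∀ {y v} → Point (y , v) → + y ≢ + e ℤ.* v) →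
    isOdd (length conjugateFixed) ≡ does (square? N)
  isOdd-conjugateFixed-0 N refl ≢ = isOdd-subsingleton unique-conjugateFixed
    (λ z∈ z′∈ → equal (axis z∈) (axis z′∈))
    (λ {z} z∈ → dec-true (square? N) (proj₁ z , proj₂ (axis z∈)))
    (λ sq → let y , eq = does-true⁻ (square? N) sq in (y , + 0) , ∈-conjugateFixed⁺ (point-0⁺ {y} eq) (inj₁ refl))
    where
    axis : ∀ {z} → z ∈ conjugateFixed → proj₂ z ≡ + 0 × proj₁ z * proj₁ z ≡ M
    axis {y , v} z∈ with ∈-conjugateFixed⁻ z∈
    ... | P , inj₁ refl = refl , point-0⁻ {y} P
    ... | P , inj₂ eq   = contradiction eq (≢ P)
    equal : ∀ {z z′ : ℕ × ℤ} → proj₂ z ≡ + 0 × proj₁ z * proj₁ z ≡ M → proj₂ z′ ≡ + 0 × proj₁ z′ * proj₁ z′ ≡ M → z ≡ z′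
    equal (refl , eq) (refl , eq′) = cong (_, + 0) (*-self-injective (trans eq (sym eq′)))

-- The mod 2 reduction of ∏ (1 − X^ j)³ over j ≥ 1, by Jacobi's identity.
ψ : Series
ψ n = does (square? (8 * n + 1))

-- For d = e = 2 the value `M` is 8 n + 1, and a point on the imaginary axis would have y = 2 v
-- even.
jacobi : θ ⊛ spread₂ θ ≗ ψ
jacobi n = trans (θ-⊛-spread (spread₂-spread θ))
  (isOdd-conjugateFixed-0 2 2 n refl (8 * n + 1) refl λ {y} {v} P y≡2v →
    point-odd P (divides ∣ v ∣ (trans (cong ∣_∣ y≡2v) (trans (ℤ.abs-* (+ 2) v) (*-comm 2 ∣ v ∣)))))
  where open Points 2 2 n refl

double≡2* : ∀ n → double n ≡ 2 * n
double≡2* zero    = refl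
double≡2* (suc n) = trans (cong (λ k → suc (suc k)) (double≡2* n)) (sym (*-suc 2 n))

8∤4 : 8 ∤ 4
8∤4 = >⇒∤ (s≤s (s≤s (s≤s (s≤s (s≤s z≤n)))))

8m+1≢8t+5 : ∀ m t → 8 * m + 1 ≢ 8 * t + 5
8m+1≢8t+5 m t eq = 8∤4 (∣m+n∣m⇒∣n (subst (8 ∣_) 8m≡8t+4 (m∣m*n m)) (m∣m*n t))
  where
  8m≡8t+4 : 8 * m ≡ 8 * t + 4
  8m≡8t+4 = +-cancelʳ-≡ 1 _ _ (trans eq (sym (+-assoc (8 * t) 4 1)))

module _ (n : ℕ) where
  open Points 5 1 n refl

  point-diagonal⁻ : ∀ {y v} → Point (y , v) → + y ≡ + 1 ℤ.* v → v ≡ + y × 5 * (y * y) ≡ M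
  point-diagonal⁻ {y} {v} (onForm P) eq = v≡ , ℤ.+-injective (trans
    (ℤ.pos-* 5 (y * y)) (trans (cong (+ 5 ℤ.*_) (ℤ.pos-* y y))
    (trans (sym (form-1-diagonal (+ y))) (trans (cong (form (+ 1) (+ y)) (sym v≡)) P))))
    where
    v≡ : v ≡ + y
    v≡ = trans (sym (ℤ.*-identityˡ v)) (sym eq)

  point-diagonal⁺ : ∀ {y} → 5 * (y * y) ≡ M → Point (y , + y)
  point-diagonal⁺ {y} eq = onForm (trans (form-1-diagonal (+ y)) (trans (cong (+ 5 ℤ.*_) (sym (ℤ.pos-* y y)))
    (trans (sym (ℤ.pos-* 5 (y * y))) (cong +_ eq))))

-- For d = 5 and e = 1 the axes give y² = 4 n + 1 and 5 y² = 4 n + 1. Odd squares are 1 modulo 8, so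
-- the parity of n selects the axis: here n = 2 m, and 5 y² = 8 m + 1 is impossible.
even-θ-⊛-spread₅-θ : even (θ ⊛ spread₅ θ) ≗ ψ
even-θ-⊛-spread₅-θ m = trans (θ-⊛-spread (spread₅-spread θ))
  (isOdd-conjugateFixed-0 5 1 (double m) refl (8 * m + 1) (sym M≡) λ {y} {v} P y≡v →
    let t , y²≡ = odd-square (point-odd P)
        _ , 5y²≡ = point-diagonal⁻ (double m) {y} {v} P y≡v
    in 8m+1≢8t+5 m (5 * t) (trans (sym M≡) (trans (sym 5y²≡) (trans (cong (5 *_) y²≡) (lemma t)))))
  where
  open Points 5 1 (double m) refl
  lemma : ∀ t → 5 * (8 * t + 1) ≡ 8 * (5 * t) + 5
  lemma = solve-∀
  lemma′ : ∀ m → 4 * (2 * m) + 1 ≡ 8 * m + 1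
  lemma′ = solve-∀
  M≡ : M ≡ 8 * m + 1
  M≡ = trans (cong (λ k → 4 * k + 1) (double≡2* m)) (lemma′ m)

-- Now `M` is 8 m + 5, so the real axis is empty. Writing y² = 8 t + 1 in 5 y² = 8 m + 5 gives m = 5
-- t, which is why `ψ` appears with X⁵.
odd-θ-⊛-spread₅-θ : odd (θ ⊛ spread₅ θ) ≗ spread₅ ψ
odd-θ-⊛-spread₅-θ m = trans (θ-⊛-spread (spread₅-spread θ))
  (isOdd-subsingleton (unique-conjugateFixed 5 1 (suc (double m)) refl)
    (λ z∈ z′∈ → equal (diagonal z∈) (diagonal z′∈)) to from)
  where
  open Points 5 1 (suc (double m)) refl
  lemma : ∀ t → 5 * (8 * t + 1) ≡ 8 * (5 * t) + 5
  lemma = solve-∀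
  lemma′ : ∀ m → 4 * suc (2 * m) + 1 ≡ 8 * m + 5
  lemma′ = solve-∀
  M≡ : M ≡ 8 * m + 5
  M≡ = trans (cong (λ k → 4 * suc k + 1) (double≡2* m)) (lemma′ m)
  Diagonal : ℕ × ℤ → Set
  Diagonal (y , v) = v ≡ + y × 5 * (y * y) ≡ M × 2 ∤ y
  diagonal : ∀ {z} → z ∈ conjugateFixed → Diagonal z
  diagonal {y , v} z∈ with ∈-conjugateFixed⁻ 5 1 (suc (double m)) refl z∈
  ... | P , inj₂ eq   = let v≡ , 5y²≡ = point-diagonal⁻ (suc (double m)) {y} {v} P eq in v≡ , 5y²≡ , point-odd P
  ... | P , inj₁ refl with t , y²≡ ← odd-square (point-odd P) =
    contradiction (trans (sym y²≡) (trans (point-0⁻ 5 1 (suc (double m)) refl {y} P) M≡)) (8m+1≢8t+5 t m)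
  equal : ∀ {z z′} → Diagonal z → Diagonal z′ → z ≡ z′
  equal {y , _} {y′ , _} (refl , eq , _) (refl , eq′ , _) =
    cong (λ y → y , + y) (*-self-injective (*-cancelˡ-≡ (y * y) (y′ * y′) 5 (trans eq (sym eq′))))
  to : ∀ {z} → z ∈ conjugateFixed → spread₅ ψ m ≡ true
  to {y , v} z∈ with _ , 5y²≡ , 2∤y ← diagonal z∈ with t , y²≡ ← odd-square 2∤y =
    Equivalence.from (spread₅-spread ψ m) (t , m≡5t , dec-true (square? (8 * t + 1)) (y , y²≡))
    where
    m≡5t : m ≡ 5 * t
    m≡5t = *-cancelˡ-≡ m (5 * t) 8 (+-cancelʳ-≡ 5 _ _
      (trans (sym M≡) (trans (sym 5y²≡) (trans (cong (5 *_) y²≡) (lemma t)))))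
  from : spread₅ ψ m ≡ true → ∃ λ z → z ∈ conjugateFixed
  from eq with t , m≡5t , ψt ← Equivalence.to (spread₅-spread ψ m) eq
          with y , y²≡ ← does-true⁻ (square? (8 * t + 1)) ψt =
    (y , + y) , ∈-conjugateFixed⁺ 5 1 (suc (double m)) refl {y} {+ y}
      (point-diagonal⁺ (suc (double m)) {y} (trans (cong (5 *_) y²≡) (trans (lemma t)
        (trans (cong (λ s → 8 * s + 5) (sym m≡5t)) (sym M≡)))))
      (inj₂ (sym (ℤ.*-identityˡ (+ y))))

θ-0 : θ 0 ≡ true
θ-0 = refl

spread₂-θ-⊛-B : spread₂ θ ⊛ B ≗ θ ⊛ spread₅ θ
spread₂-θ-⊛-B n = begin
  (spread₂ θ ⊛ B) n ≡⟨ ⊛-congʳ B (⊛-self θ) n ⟨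
  ((θ ⊛ θ) ⊛ B) n   ≡⟨ ⊛-assoc θ θ B n ⟩
  (θ ⊛ (θ ⊛ B)) n   ≡⟨ ⊛-congˡ θ θ-⊛-B n ⟩
  (θ ⊛ spread₅ θ) n ∎
  where open ≡-Reasoning

-- After multiplication by `θ` both sides are `ψ`: the left by the even part of θ(X) θ(X⁵), the
-- right by `jacobi`.
even-B : even B ≗ spread₂ θ
even-B = ⊛-cancelˡ θ θ-0 λ n → begin
  (θ ⊛ even B) n           ≡⟨ even-spread₂-⊛ θ B n ⟨
  even (spread₂ θ ⊛ B) n   ≡⟨ spread₂-θ-⊛-B (double n) ⟩
  even (θ ⊛ spread₅ θ) n   ≡⟨ even-θ-⊛-spread₅-θ n ⟩
  ψ n                      ≡⟨ jacobi n ⟨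
  (θ ⊛ spread₂ θ) n        ∎
  where open ≡-Reasoning

-- Jacobi's identity at X⁵ splits ψ(X⁵) as θ(X⁵) θ(X¹⁰), and replacing θ(X⁵) by θ(X) times `B`
-- brings `B` back. Its cofactor θ(X¹⁰) is a series in X², so the separation can be repeated.
odd-B : odd B ≗ spread₂ (spread₅ θ) ⊛ B
odd-B = ⊛-cancelˡ θ θ-0 λ n → begin
  (θ ⊛ odd B) n                        ≡⟨ odd-spread₂-⊛ θ B n ⟨
  odd (spread₂ θ ⊛ B) n                ≡⟨ spread₂-θ-⊛-B (suc (double n)) ⟩
  odd (θ ⊛ spread₅ θ) n                ≡⟨ odd-θ-⊛-spread₅-θ n ⟩
  spread₅ ψ n                          ≡⟨ spread₅-cong jacobi n ⟨
  spread₅ (θ ⊛ spread₂ θ) n            ≡⟨ spread₅-⊛ θ (spread₂ θ) n ⟩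
  (spread₅ θ ⊛ spread₅ (spread₂ θ)) n  ≡⟨ ⊛-cong (λ k → sym (θ-⊛-B k)) spread₅-spread₂ n ⟩
  ((θ ⊛ B) ⊛ spread₂ (spread₅ θ)) n    ≡⟨ ⊛-assoc θ B (spread₂ (spread₅ θ)) n ⟩
  (θ ⊛ (B ⊛ spread₂ (spread₅ θ))) n    ≡⟨ ⊛-congˡ θ (⊛-comm B (spread₂ (spread₅ θ))) n ⟩
  (θ ⊛ (spread₂ (spread₅ θ) ⊛ B)) n    ∎
  where
  open ≡-Reasoning
  spread₅-spread₂ : spread₅ (spread₂ θ) ≗ spread₂ (spread₅ θ)
  spread₅-spread₂ n = trans (spread₅-cong (λ k → sym (⊛-self θ k)) n)
    (trans (spread₅-⊛ θ θ n) (⊛-self (spread₅ θ) n))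

even-odd-B : even (odd B) ≗ spread₅ θ ⊛ spread₂ θ
even-odd-B n = begin
  even (odd B) n                       ≡⟨ odd-B (double n) ⟩
  even (spread₂ (spread₅ θ) ⊛ B) n     ≡⟨ even-spread₂-⊛ (spread₅ θ) B n ⟩
  (spread₅ θ ⊛ even B) n               ≡⟨ ⊛-congˡ (spread₅ θ) even-B n ⟩
  (spread₅ θ ⊛ spread₂ θ) n            ∎
  where open ≡-Reasoning

⊛-vanish : ∀ f g n → (∀ {z} → ¬ Solution f g n z) → (f ⊛ g) n ≡ false
⊛-vanish f g n none = trans (sym (isOdd-solutions f g n)) (empty (solutions f g n) (∈-solutions⁻ f g n))
  where
  empty : ∀ zs → (∀ {z} → z ∈ zs → Solution f g n z) → isOdd (length zs) ≡ false
  empty []       _     = refl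
  empty (z ∷ zs) sound = contradiction (sound (here refl)) none

B-4n+1 : ∀ n → (∀ x y → 2 * (x * x) + 5 * (y * y) ≢ 24 * n + 7) → B (4 * n + 1) ≡ false
B-4n+1 n none = trans (cong B index≡) (trans (even-odd-B n)
  (⊛-vanish (spread₅ θ) (spread₂ θ) n λ {z} → no-solution {z}))
  where
  lemma : ∀ n → 4 * n + 1 ≡ suc (2 * (2 * n))
  lemma = solve-∀
  index≡ : 4 * n + 1 ≡ suc (double (double n))
  index≡ = trans (lemma n) (cong suc (trans (cong (2 *_) (sym (double≡2* n))) (sym (double≡2* (double n)))))
  lemma′ : ∀ i j → 2 * (24 * j + 1) + 5 * (24 * i + 1) ≡ 24 * (5 * i + 2 * j) + 7
  lemma′ = solve-∀
  no-solution : ∀ {z} → ¬ Solution (spread₅ θ) (spread₂ θ) n z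
  no-solution {k , l} (k+l≡n , θk , θl)
    with i , refl , θi ← Equivalence.to (spread₅-spread θ k) θk
    with j , refl , θj ← Equivalence.to (spread₂-spread θ l) θl
    = none (proj₁ sq-j) (proj₁ sq-i) (trans (cong₂ (λ s t → 2 * s + 5 * t) (proj₂ sq-j) (proj₂ sq-i))
        (trans (lemma′ i j) (cong (λ s → 24 * s + 7) k+l≡n)))
    where
    sq-i : Square (24 * i + 1)
    sq-i = θ-true⁻ {i} θi
    sq-j : Square (24 * j + 1)
    sq-j = θ-true⁻ {j} θj

-- The form 2 x² + 5 y² at an inert prime

legendre≡-1⇒nonResidue : ∀ a p → legendre a p ≡ -1ℤ → ¬ QuadraticResidue a p
legendre≡-1⇒nonResidue a p eq residue = absurd (does (+ p ℤ.∣? a))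
  (subst (λ c → (if does (+ p ℤ.∣? a) then 0ℤ else if c then 1ℤ else -1ℤ) ≡ -1ℤ)
         (dec-true (quadraticResidue? a p) residue) eq)
  where
  absurd : ∀ c → ¬ ((if c then 0ℤ else 1ℤ) ≡ -1ℤ)
  absurd true  ()
  absurd false ()

module _ {p : ℕ} (p-prime : Prime p) where

  private instance
    p-nonZero : NonZero p
    p-nonZero = prime⇒nonZero p-prime

  -- `QuadraticResidue` wants a root in `Fin p`, so w is replaced by its remainder r; with quotient
  -- q, the value w² - a changes by the multiple q (w + r) p of p.
  square⇒residue : ∀ a w → + p ℤ.∣ w ℤ.* w ℤ.- a → QuadraticResidue a p
  square⇒residue a w p∣ = fromℕ< r<p , subst (λ r → + p ℤ.∣ + r ℤ.* + r ℤ.- a) (sym (toℕ-fromℕ< r<p))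
    (subst (+ p ℤ.∣_) (sym expand) (ℤ.∣m∣n⇒∣m-n p∣ (ℤ.∣n⇒∣m*n (q ℤ.* (w ℤ.+ + r)) (ℤ.∣-refl {+ p}))))
    where
    r = w ℤ.%ℕ p
    q = w ℤ./ℕ p
    r<p : r < p
    r<p = ℤ.n%ℕd<d w p
    lemma : ∀ r q p a → r ℤ.* r ℤ.- a
      ≡ (r ℤ.+ q ℤ.* p) ℤ.* (r ℤ.+ q ℤ.* p) ℤ.- a ℤ.- q ℤ.* (r ℤ.+ q ℤ.* p ℤ.+ r) ℤ.* p
    lemma = ℤ.solve-∀
    expand : + r ℤ.* + r ℤ.- a ≡ w ℤ.* w ℤ.- a ℤ.- q ℤ.* (w ℤ.+ + r) ℤ.* + p
    expand = trans (lemma (+ r) q (+ p) a)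
      (cong (λ w → w ℤ.* w ℤ.- a ℤ.- q ℤ.* (w ℤ.+ + r) ℤ.* + p) (sym (ℤ.a≡a%ℕn+[a/ℕn]*n w p)))

  ∤⇒inverse : ∀ {y} → p ∤ y → ∃ λ z → + p ℤ.∣ + y ℤ.* z ℤ.- + 1
  ∤⇒inverse {y} p∤y = go (coprime-Bézout coprime)
    where
    coprime : Coprime p y
    coprime (d∣p , d∣y) with prime⇒irreducible p-prime d∣p
    ... | inj₁ d≡1  = d≡1
    ... | inj₂ refl = contradiction d∣y p∤y
    go : Bézout.Identity 1 p y → ∃ λ z → + p ℤ.∣ + y ℤ.* z ℤ.- + 1
    go (Bézout.+- a c eq) = - (+ c) , ℤ.divides (- (+ a)) (trans (lemma (+ c) (+ y)) (trans (cong -_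
      (trans (cong (λ s → + 1 ℤ.+ s) (sym (ℤ.pos-* c y))) (trans (cong +_ eq) (ℤ.pos-* a p))))
      (ℤ.neg-distribˡ-* (+ a) (+ p))))
      where
      lemma : ∀ c y → y ℤ.* (- c) ℤ.- + 1 ≡ - (+ 1 ℤ.+ c ℤ.* y)
      lemma = ℤ.solve-∀
    go (Bézout.-+ a c eq) = + c , ℤ.divides (+ a) (trans
      (cong (ℤ._- + 1) (trans (ℤ.*-comm (+ y) (+ c)) (trans (sym (ℤ.pos-* c y))
      (trans (cong +_ (sym eq)) (cong (λ s → + 1 ℤ.+ s) (ℤ.pos-* a p)))))) (lemma (+ a ℤ.* + p)))
      where
      lemma : ∀ s → + 1 ℤ.+ s ℤ.- + 1 ≡ s
      lemma = ℤ.solve-∀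

  module _ (5≤p : 5 ≤ p) (nonResidue : ¬ QuadraticResidue (- (+ 10)) p) where

    small∤ : ∀ d .{{_ : NonTrivial d}} → d < 5 → d ∤ p
    small∤ d d<5 d∣p with prime⇒irreducible p-prime d∣p
    small∤ .1 {{()}} _ _ | inj₁ refl
    ... | inj₂ refl = <⇒≱ d<5 5≤p

    -- If z inverts y modulo p, then 2 x z is a square root of -10: (2xz)² + 10 = 2z² (2x² + 5y²) -
    -- 10 (yz + 1) (yz - 1).
    ∣form⇒∣y : ∀ x y → p ∣ 2 * (x * x) + 5 * (y * y) → p ∣ y
    ∣form⇒∣y x y p∣ with p ∣? y
    ... | yes p∣y = p∣y
    ... | no p∤y with z , p∣yz-1 ← ∤⇒inverse p∤y = contradiction
      (square⇒residue (- (+ 10)) (+ 2 ℤ.* + x ℤ.* z) (subst (+ p ℤ.∣_) (sym (lemma (+ x) (+ y) z))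
        (ℤ.∣m∣n⇒∣m-n (ℤ.∣n⇒∣m*n (+ 2 ℤ.* z ℤ.* z) (subst (+ p ℤ.∣_) cast (ℤ.∣ᵤ⇒∣ p∣)))
                     (ℤ.∣n⇒∣m*n (+ 10 ℤ.* (+ y ℤ.* z ℤ.+ + 1)) p∣yz-1))))
      nonResidue
      where
      cast : + (2 * (x * x) + 5 * (y * y)) ≡ + 2 ℤ.* (+ x ℤ.* + x) ℤ.+ + 5 ℤ.* (+ y ℤ.* + y)
      cast = cong₂ ℤ._+_ (trans (ℤ.pos-* 2 (x * x)) (cong (+ 2 ℤ.*_) (ℤ.pos-* x x)))
                         (trans (ℤ.pos-* 5 (y * y)) (cong (+ 5 ℤ.*_) (ℤ.pos-* y y)))
      lemma : ∀ x y z → + 2 ℤ.* x ℤ.* z ℤ.* (+ 2 ℤ.* x ℤ.* z) ℤ.- (- (+ 10))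
        ≡ + 2 ℤ.* z ℤ.* z ℤ.* (+ 2 ℤ.* (x ℤ.* x) ℤ.+ + 5 ℤ.* (y ℤ.* y))
          ℤ.- + 10 ℤ.* (y ℤ.* z ℤ.+ + 1) ℤ.* (y ℤ.* z ℤ.- + 1)
      lemma = ℤ.solve-∀

    ∣form⇒∣x : ∀ x y → p ∣ 2 * (x * x) + 5 * (y * y) → p ∣ x
    ∣form⇒∣x x y p∣ with euclidsLemma 2 (x * x) p-prime (∣m+n∣m⇒∣n
        (subst (p ∣_) (+-comm (2 * (x * x)) (5 * (y * y))) p∣) (∣n⇒∣m*n 5 (∣m⇒∣m*n y (∣form⇒∣y x y p∣))))
    ... | inj₁ p∣2 = contradiction p∣2 (>⇒∤ (≤-trans (s≤s (s≤s (s≤s z≤n))) 5≤p))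
    ... | inj₂ p∣x*x = [ (λ h → h) , (λ h → h) ]′ (euclidsLemma x x p-prime p∣x*x)

    -- Descent: p divides both x and y, so dividing by p² gives another represented value with the
    -- exponent lowered by two. When the exponent is 1, cancelling p leaves p ∣ t.
    odd-power-not-represented : ∀ a {t} → p ∤ t → ∀ x y → 2 * (x * x) + 5 * (y * y) ≢ p ^ suc (2 * a) * t
    odd-power-not-represented a {t} p∤t x y eq
      with p∣ ← subst (p ∣_) (sym eq) (∣m⇒∣m*n t (m∣m*n (p ^ (2 * a))))
      with divides x′ refl ← ∣form⇒∣x x y p∣
      with divides y′ refl ← ∣form⇒∣y x y p∣ = descend a
        (*-cancelˡ-≡ _ _ p (trans (lemma p x′ y′) (trans eq (*-assoc p (p ^ (2 * a)) t))))
      where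
      lemma : ∀ p x y → p * (p * (2 * (x * x) + 5 * (y * y))) ≡ 2 * (x * p * (x * p)) + 5 * (y * p * (y * p))
      lemma = solve-∀
      descend : ∀ a → p * (2 * (x′ * x′) + 5 * (y′ * y′)) ≢ p ^ (2 * a) * t
      descend zero    eq = p∤t (subst (p ∣_) (trans eq (*-identityˡ t)) (m∣m*n _))
      descend (suc a) eq = odd-power-not-represented a p∤t x′ y′ (*-cancelˡ-≡ _ _ p
        (trans eq (trans (cong (λ k → p ^ k * t) (*-suc 2 a)) (*-assoc p (p ^ suc (2 * a)) t))))

    -- The modulus is 24 because the offset, itself a quotient by 6, has to be known modulo 4 for
    -- `B-4n+1` to apply.
    p^2α≡24k+1 : ∀ α → ∃ λ k → p ^ (2 * α) ≡ 24 * k + 1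
    p^2α≡24k+1 α = subst (λ q → ∃ λ k → q ≡ 24 * k + 1) (^-*-assoc p 2 α) (power α)
      where
      base : ∃ λ k → p * p ≡ 24 * k + 1
      base = coprime-square (small∤ 2 (s≤s (s≤s (s≤s z≤n)))) (small∤ 3 (s≤s (s≤s (s≤s (s≤s z≤n)))))
      lemma : ∀ j k → (24 * j + 1) * (24 * k + 1) ≡ 24 * (24 * j * k + j + k) + 1
      lemma = solve-∀
      power : ∀ α → ∃ λ k → (p ^ 2) ^ α ≡ 24 * k + 1
      power zero    = 0 , refl
      power (suc α) with j , eqj ← base with k , eqk ← power α =
        24 * j * k + j + k , trans (cong₂ _*_ (trans (cong (p *_) (*-identityʳ p)) eqj) eqk) (lemma j k)

theorem3p17 :
    ∀ (p : ℕ) → Prime p → 5 ≤ p → legendre (- (+ 10)) p ≡ -1ℤ →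
    ∀ (α n : ℕ) → 1 ≤ α →
    ∀ (i : ℕ) → 1 ≤ i → i ≤ p ∸ 1 →
    2 ∣ b 5 (4 * p ^ (2 * α) * n + ((24 * i + 7 * p) * p ^ (2 * α ∸ 1) ∸ 1) / 6)
theorem3p17 p p-prime 5≤p leg (suc a) n _ i 1≤i i≤p-1 =
  ¬isOdd⇒2∣ (b 5 (4 * p ^ (2 * suc a) * n + O)) (subst (λ N → B N ≡ false) (sym N≡)
    (B-4n+1 m λ x y eq → odd-power-not-represented p-prime 5≤p nonResidue a p∤t x y (trans eq 24m+7≡)))
  where
  instance
    p-nonZero : NonZero p
    p-nonZero = prime⇒nonZero p-prime
  nonResidue : ¬ QuadraticResidue (- (+ 10)) p
  nonResidue = legendre≡-1⇒nonResidue (- (+ 10)) p leg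
  -- As α = a + 1, `P` is p^(2α - 1). The cofactor `t` is read off from 24 m + 7 = P t, proved as
  -- `24m+7≡`.
  P O t : ℕ
  P = p ^ suc (2 * a)
  O = ((24 * i + 7 * p) * p ^ (2 * suc a ∸ 1) ∸ 1) / 6
  t = 24 * p * n + 24 * i + 7 * p
  P≡ : p ^ (2 * suc a ∸ 1) ≡ P
  P≡ = cong (p ^_) (cong (_∸ 1) (*-suc 2 a))
  pP≡ : p ^ (2 * suc a) ≡ p * P
  pP≡ = cong (p ^_) (*-suc 2 a)
  s : ℕ
  s = proj₁ (p^2α≡24k+1 p-prime 5≤p nonResidue (suc a))
  pP≡24s+1 : p * P ≡ 24 * s + 1
  pP≡24s+1 = trans (sym pP≡) (proj₂ (p^2α≡24k+1 p-prime 5≤p nonResidue (suc a)))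
  -- Substituting p P = 24 s + 1 into 6 O + 1 = 24 i P + 7 p P gives O = 4 u + 1; adding 4 p P n
  -- then makes the argument of `b 5` equal to 4 m + 1.
  u m : ℕ
  u = i * P + 7 * s
  m = p * P * n + u
  O≡ : O ≡ 4 * u + 1
  O≡ = *-cancelˡ-≡ O (4 * u + 1) 6 (+-cancelʳ-≡ 1 _ _ (begin
    6 * O + 1                              ≡⟨ offset-exact p p-prime 5≤p (suc a) (s≤s z≤n) i ⟨
    (24 * i + 7 * p) * p ^ (2 * suc a ∸ 1) ≡⟨ cong ((24 * i + 7 * p) *_) P≡ ⟩
    (24 * i + 7 * p) * P                   ≡⟨ l₁ i p P ⟩
    24 * (i * P) + 7 * (p * P)             ≡⟨ cong (λ q → 24 * (i * P) + 7 * q) pP≡24s+1 ⟩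
    24 * (i * P) + 7 * (24 * s + 1)        ≡⟨ l₂ (i * P) s ⟩
    6 * (4 * u + 1) + 1                    ∎))
    where
    open ≡-Reasoning
    l₁ : ∀ i p P → (24 * i + 7 * p) * P ≡ 24 * (i * P) + 7 * (p * P)
    l₁ = solve-∀
    l₂ : ∀ k s → 24 * k + 7 * (24 * s + 1) ≡ 6 * (4 * (k + 7 * s) + 1) + 1
    l₂ = solve-∀
  N≡ : 4 * p ^ (2 * suc a) * n + O ≡ 4 * m + 1
  N≡ = trans (cong₂ (λ q o → 4 * q * n + o) pP≡ O≡) (lemma (p * P) n u)
    where
    lemma : ∀ q n u → 4 * q * n + (4 * u + 1) ≡ 4 * (q * n + u) + 1
    lemma = solve-∀
  24m+7≡ : 24 * m + 7 ≡ P * t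
  24m+7≡ = trans (l₁ (p * P) n (i * P) s)
    (trans (cong (λ q → 24 * (p * P * n) + 24 * (i * P) + 7 * q) (sym pP≡24s+1)) (l₂ p P n i))
    where
    l₁ : ∀ q n k s → 24 * (q * n + (k + 7 * s)) + 7 ≡ 24 * (q * n) + 24 * k + 7 * (24 * s + 1)
    l₁ = solve-∀
    l₂ : ∀ p P n i → 24 * (p * P * n) + 24 * (i * P) + 7 * (p * P) ≡ P * (24 * p * n + 24 * i + 7 * p)
    l₂ = solve-∀
  p∤i : p ∤ i
  p∤i = >⇒∤ {{>-nonZero 1≤i}} (≤-<-trans i≤p-1 (≤-reflexive (m+[n∸m]≡n {1} {p} (≤-trans (s≤s z≤n) 5≤p))))
  p∤24 : p ∤ 24
  p∤24 p∣24 with euclidsLemma 4 6 p-prime p∣24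
  ... | inj₁ p∣4 = >⇒∤ 5≤p p∣4
  ... | inj₂ p∣6 with euclidsLemma 2 3 p-prime p∣6
  ... | inj₁ p∣2 = >⇒∤ (≤-trans (s≤s (s≤s (s≤s z≤n))) 5≤p) p∣2
  ... | inj₂ p∣3 = >⇒∤ (≤-trans (s≤s (s≤s (s≤s (s≤s z≤n)))) 5≤p) p∣3
  -- Modulo p only 24 i is left of `t`, and 1 ≤ i < p.
  p∤t : p ∤ t
  p∤t p∣t = [ p∤24 , p∤i ]′ (euclidsLemma 24 i p-prime
    (∣m+n∣m⇒∣n (subst (p ∣_) (lemma p n i) p∣t) (m∣m*n (24 * n + 7))))
    where
    lemma : ∀ p n i → 24 * p * n + 24 * i + 7 * p ≡ p * (24 * n + 7) + 24 * i
    lemma = solve-∀
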